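{- As formal Laurent series in $q$, \[ \frac{1}{q}\frac{(-q;q^2)_{\infty}}{(q^3;q^2)_{\infty}}\sum_{n=0}^{\infty}\frac{(q;q^2)_n(-q)^n}{(-q;q^2)_{n}(1+q^{2n})}p_{2n}(-1;q^{ -2n-1},-1:q)\equiv\frac{1}{2q}-\frac{1}{2}\pmod{4}, \] i.e. the difference of the two sides is a Laurent series whose coefficients are all integers divisible by $4$.
   Context: $(a;q)_n=\prod_{k=0}^{n-1}(1-aq^k)$, $(a;q)_\infty=\prod_{k\ge0}(1-aq^k)$. Here $p_{2n}(-1;q^{ -2n-1},-1:q)$ denotes the little $q$-Jacobi polynomial $p_N(x;a,b:q)={}_2\phi_1(q^{ -N},abq^{N+1};aq;q,qx)$ at these parameters, understood as the terminating sum $\sum_{p=0}^{2n}\frac{(-1;q)_p(-q)^p}{(q;q)_p}$. -}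

module Defs where

open import Data.Nat as ℕ using (ℕ; zero; suc)
open import Data.Integer as ℤ using (ℤ; +_; -[1+_])
open import Data.Rational as ℚ using (ℚ; 0ℚ; 1ℚ; ½; -½; 1/_; ≢-nonZero)
open import Data.Rational.Properties using (_≟_)
open import Data.List using (List; []; _∷_; foldr; map; upTo; zipWith)
open import Data.Product using (∃)
open import Relation.Binary.PropositionalEquality using (_≡_)
open import Relation.Nullary using (yes; no)

FPS : Set
FPS = ℕ → ℚ

-- Formal Laurent series: coefficient of q^k for every k : ℤ
-- (we only ever build ones with finitely many negative-degree terms).
Laurent : Set
Laurent = ℤ → ℚ

sumℚ : List ℚ → ℚ
sumℚ = foldr ℚ._+_ 0ℚ

const : ℚ → FPS
const c zero    = c
const c (suc _) = 0ℚ

one : FPS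
one = const 1ℚ

mono : ℚ → ℕ → FPS
mono c zero    zero    = c
mono c zero    (suc _) = 0ℚ
mono c (suc k) zero    = 0ℚ
mono c (suc k) (suc m) = mono c k m

qS : FPS
qS = mono 1ℚ 1

_⊕_ : FPS → FPS → FPS
(f ⊕ g) m = f m ℚ.+ g m

_⊝_ : FPS → FPS → FPS
(f ⊝ g) m = f m ℚ.- g m

_⊛_ : FPS → FPS → FPS
(f ⊛ g) m = sumℚ (map (λ i → f i ℚ.* g (m ℕ.∸ i)) (upTo (suc m)))

infixl 6 _⊕_ _⊝_
infixl 7 _⊛_

powS : FPS → ℕ → FPS
powS f zero    = one
powS f (suc n) = f ⊛ powS f n

sumUpTo : ℕ → (ℕ → FPS) → FPS
sumUpTo zero    F = const 0ℚ
sumUpTo (suc N) F = sumUpTo N F ⊕ F N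

prodUpTo : ℕ → (ℕ → FPS) → FPS
prodUpTo zero    F = one
prodUpTo (suc N) F = prodUpTo N F ⊛ F N

-- Multiplicative inverse of a power series with nonzero constant term a₀:
-- b₀ = 1/a₀,  b_m = -(1/a₀) Σ_{i=1}^{m} a_i b_{m-i}.
-- (If a₀ = 0 the series is not invertible; we then return 0, a value
-- never used in the statement.)
module _ (a : FPS) where
  private
    c : ℚ
    c with a 0 ≟ 0ℚ
    ... | yes _ = 0ℚ
    ... | no a₀≢0 = 1/_ (a 0) {{≢-nonZero a₀≢0}}

    -- revCoeffs m = [b_m, b_{m-1}, …, b_0]
    revCoeffs : ℕ → List ℚ
    revCoeffs zero    = c ∷ []
    revCoeffs (suc m) =
      (ℚ.- (c ℚ.* sumℚ (zipWith ℚ._*_ (map (λ j → a (suc j)) (upTo (suc m)))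
                                    (revCoeffs m))))
      ∷ revCoeffs m

    headℚ : List ℚ → ℚ
    headℚ []      = 0ℚ
    headℚ (x ∷ _) = x

  invS : FPS
  invS m = headℚ (revCoeffs m)

poch : FPS → FPS → ℕ → FPS
poch a b n = prodUpTo n (λ k → one ⊝ a ⊛ powS b k)

-- (a;b)_∞ as the q-adic limit of (a;b)_n.  When a and b have zero
-- constant term (the only case used), the factor 1 - a b^k ≡ 1 mod q^{k+1},
-- so the coefficient of q^m of (a;b)_∞ equals that of (a;b)_{m+1}.
pochInf : FPS → FPS → FPS
pochInf a b m = poch a b (suc m) m

-- Σ_{n≥0} T n as the q-adic limit of its partial sums; valid when
-- T n ≡ 0 mod q^n (the only case used), in which case the coefficient of
-- q^m is that of Σ_{n≤m} T n.
sumInf : (ℕ → FPS) → FPS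
sumInf T m = sumUpTo (suc m) T m

minusQ : FPS
minusQ = mono (ℚ.- 1ℚ) 1

-- little q-Jacobi p_N(-1; q^{-2n-1}, -1 : q) as the terminating sum
-- Σ_{p=0}^{N} (-1;q)_p (-q)^p / (q;q)_p   (used with N = 2n)
pJac : ℕ → FPS
pJac N = sumUpTo (suc N) (λ p →
  poch (const (ℚ.- 1ℚ)) qS p ⊛ powS minusQ p ⊛ invS (poch qS qS p))

summand : ℕ → FPS
summand n =
  poch qS (powS qS 2) n ⊛ powS minusQ n
    ⊛ invS (poch minusQ (powS qS 2) n)
    ⊛ invS (one ⊕ powS qS (2 ℕ.* n))
    ⊛ pJac (2 ℕ.* n)

mainSeries : FPS
mainSeries =
  pochInf minusQ (powS qS 2) ⊛ invS (pochInf (powS qS 3) (powS qS 2))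
    ⊛ sumInf summand

qInvTimes : FPS → Laurent
qInvTimes f (+ k)      = f (suc k)
qInvTimes f -[1+ zero ] = f 0
qInvTimes f -[1+ suc _ ] = 0ℚ

lhs : Laurent
lhs = qInvTimes mainSeries

rhs : Laurent
rhs -[1+ zero ]  = ½
rhs -[1+ suc _ ] = 0ℚ
rhs (+ zero)     = -½
rhs (+ suc _)    = 0ℚ

DivBy4 : ℚ → Set
DivBy4 x = ∃ λ (z : ℤ) → x ≡ (+ 4 ℤ.* z) ℚ./ 1

-- Write r n for (q;q²)_n / (-q;q²)_n and P for the prefactor.  Then P r ∞ = 1 - q, the n = 0 term
-- of the series is 1/2, and r telescopes: 1 - r ∞ = 2 ∑ r n q^(2n+1) / (1 + q^(2n+1)).  So the
-- claim is that P times
--   ∑_{n ≥ 1} (term n of the series) + ∑_{n ≥ 0} r n q^(2n+1) / (1 + q^(2n+1))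
-- vanishes modulo 4.  Put λ e = q^e / (1 - q^e).  Modulo 4 one has p_{2n} = 1 + 2 ∑_{1 ≤ e ≤ 2n} λ e
-- and r n = 1 + 2 ∑_{k < n} λ (2k+1), and the sum becomes
--   ∑ (-q)^n / (1 + q^(2n)) + ∑ q^(2n+1) / (1 + q^(2n+1))
--     + 2 (∑_{1 ≤ k ≤ n} q^n / (1 - q^(2n)) λ (2k) + ∑_{k < n} λ (2n+1) λ (2k+1)).
-- The first line is 2 ∑ j q^(n(2j+1)), as is twice the diagonal k = n of the first double sum.
-- The rest of that double sum equals the second one by conjugation of partitions with exactly
-- two part sizes.  Hence the total is divisible by 4.
--
-- Infinite sums and products are truncated by working modulo q^N.
module Submission where

open import Defs
open import Data.Integer using (ℤ)
open import Algebra.Bundles using (CommutativeRing; RawRing)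
import Algebra.Solver.Ring.NaturalCoefficients.Default as SemiringSolver
open import Data.Integer as ℤ using (+_; -[1+_])
import Data.Integer.Tactic.RingSolver as ℤ-Solver
open import Data.List using (List; map; upTo; applyUpTo)
open import Data.List.Properties using (map-applyUpTo)
open import Data.Nat as ℕ using (ℕ; zero; suc; _≤_; _<_; z≤n; s≤s)
import Data.Nat.Properties as ℕ
import Data.Nat.Tactic.RingSolver as ℕ-Solver
open import Data.Product using (∃; _×_; _,_; proj₁; proj₂)
open import Data.Rational as ℚ using (ℚ; 0ℚ; 1ℚ; ½; ≢-nonZero)
import Data.Rational.Properties as ℚ
import Data.Rational.Unnormalised as ℚᵘ
import Data.Rational.Unnormalised.Properties as ℚᵘ
open import Function using (_∘_; id)
open import Level as Level using (0ℓ)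
open import Relation.Binary.PropositionalEquality as ≡ using (_≡_; _≢_)
open import Relation.Nullary using (yes; no; contradiction)

-- The q-series of the statement as truncated expressions over an arbitrary ring.

module Expressions {c ℓ} (R : RawRing c ℓ) where
  open RawRing R
  open import Algebra.Definitions.RawSemiring rawSemiring public using (_^_)

  infixl 6 _-_
  _-_ : Carrier → Carrier → Carrier
  x - y = x + (- y)

  ∑ ∏ : ℕ → (ℕ → Carrier) → Carrier
  ∑ zero    f = 0#
  ∑ (suc n) f = ∑ n f + f n
  ∏ zero    f = 1#
  ∏ (suc n) f = ∏ n f * f n

  qPoch : Carrier → Carrier → ℕ → Carrier
  qPoch a b n = ∏ n (λ k → 1# - a * b ^ k)

  -- Truncated geometric series: the inverse of x as soon as (1 - x) ^ N vanishes.
  inv : ℕ → Carrier → Carrier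
  inv N x = ∑ N (λ i → (1# - x) ^ i)

  -- Only the ring operations occur here, so that the same terms can be evaluated both on rational
  -- series and on integral series modulo 4, and then compared through `proj₁`.
  module _ (N : ℕ) (q : Carrier) where

    jacobi : ℕ → Carrier
    jacobi m = ∑ (suc m) (λ p → qPoch (- 1#) q p * (- q) ^ p * inv N (qPoch q q p))

    term : ℕ → Carrier
    term n = qPoch q (q ^ 2) n * (- q) ^ n * inv N (qPoch (- q) (q ^ 2) n)
      * inv N (1# + q ^ (2 ℕ.* n)) * jacobi (2 ℕ.* n)

    ratio : ℕ → Carrier
    ratio n = qPoch q (q ^ 2) n * inv N (qPoch (- q) (q ^ 2) n)

    -- Once `q ^ N` vanishes, twice this is `ratio n - ratio (suc n)`; the undoubled form avoids a
    -- division by 2.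
    telescoping : ℕ → Carrier
    telescoping n = ratio n * (q ^ suc (2 ℕ.* n) * inv N (1# + q ^ suc (2 ℕ.* n)))

    -- The term of index 0 contains 1/2 and is left out, so that what remains lives over the
    -- integers and can be reduced modulo 4.
    remainder : Carrier
    remainder = ∑ N (term ∘ suc) + ∑ N telescoping

    prefactor : Carrier
    prefactor = qPoch (- q) (q ^ 2) N * inv N (qPoch (q ^ 3) (q ^ 2) N)

-- Finite sums and products in a commutative ring.

module FiniteSums {c ℓ} (R : CommutativeRing c ℓ) where
  open CommutativeRing R hiding (_-_)
  open Expressions rawRing public
  open import Relation.Binary.Reasoning.Setoid setoid
  open SemiringSolver commutativeSemiring using (solve; con; _:+_; _:*_; _:=_)

  ∑-cong : ∀ n {f g : ℕ → Carrier} → (∀ i → f i ≈ g i) → ∑ n f ≈ ∑ n g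
  ∑-cong zero    f≈g = refl
  ∑-cong (suc n) f≈g = +-cong (∑-cong n f≈g) (f≈g n)

  ∏-cong : ∀ n {f g : ℕ → Carrier} → (∀ i → f i ≈ g i) → ∏ n f ≈ ∏ n g
  ∏-cong zero    f≈g = refl
  ∏-cong (suc n) f≈g = *-cong (∏-cong n f≈g) (f≈g n)

  ∑-zero : ∀ n {f : ℕ → Carrier} → (∀ i → f i ≈ 0#) → ∑ n f ≈ 0#
  ∑-zero zero    f≈0 = refl
  ∑-zero (suc n) f≈0 = trans (+-cong (∑-zero n f≈0) (f≈0 n)) (+-identityˡ 0#)

  ∑-+ : ∀ n (f g : ℕ → Carrier) → ∑ n (λ i → f i + g i) ≈ ∑ n f + ∑ n g
  ∑-+ zero    f g = sym (+-identityˡ 0#)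
  ∑-+ (suc n) f g = trans (+-congʳ (∑-+ n f g))
    (solve 4 (λ a b c d → (a :+ b) :+ (c :+ d) := (a :+ c) :+ (b :+ d)) refl
      (∑ n f) (∑ n g) (f n) (g n))

  ∑-*ˡ : ∀ n x (f : ℕ → Carrier) → x * ∑ n f ≈ ∑ n (λ i → x * f i)
  ∑-*ˡ zero    x f = zeroʳ x
  ∑-*ˡ (suc n) x f = trans (distribˡ x _ _) (+-congʳ (∑-*ˡ n x f))

  ∑-*ʳ : ∀ n x (f : ℕ → Carrier) → ∑ n f * x ≈ ∑ n (λ i → f i * x)
  ∑-*ʳ n x f = trans (*-comm _ x) (trans (∑-*ˡ n x f) (∑-cong n (λ i → *-comm x (f i))))

  ∑-* : ∀ m n (f g : ℕ → Carrier) → ∑ m f * ∑ n g ≈ ∑ m (λ i → ∑ n (λ j → f i * g j))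
  ∑-* m n f g = trans (∑-*ʳ m (∑ n g) f) (∑-cong m (λ i → ∑-*ˡ n (f i) g))

  ∑-swap : ∀ m n (f : ℕ → ℕ → Carrier) →
    ∑ m (λ i → ∑ n (f i)) ≈ ∑ n (λ j → ∑ m (λ i → f i j))
  ∑-swap zero    n f = sym (∑-zero n (λ _ → refl))
  ∑-swap (suc m) n f = trans (+-congʳ (∑-swap m n f)) (sym (∑-+ n _ (f m)))

  ∑-swap₂ : ∀ n (f : ℕ → ℕ → ℕ → ℕ → Carrier) →
    ∑ n (λ a → ∑ n (λ b → ∑ n (λ c → ∑ n (λ d → f a b c d)))) ≈
    ∑ n (λ c → ∑ n (λ d → ∑ n (λ a → ∑ n (λ b → f a b c d))))
  ∑-swap₂ n f = begin
    ∑ n (λ a → ∑ n (λ b → ∑ n (λ c → ∑ n (λ d → f a b c d))))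
      ≈⟨ ∑-cong n (λ a → ∑-swap n n _) ⟩
    ∑ n (λ a → ∑ n (λ c → ∑ n (λ b → ∑ n (λ d → f a b c d))))
      ≈⟨ ∑-swap n n _ ⟩
    ∑ n (λ c → ∑ n (λ a → ∑ n (λ b → ∑ n (λ d → f a b c d))))
      ≈⟨ ∑-cong n (λ c → ∑-cong n (λ a → ∑-swap n n _)) ⟩
    ∑ n (λ c → ∑ n (λ a → ∑ n (λ d → ∑ n (λ b → f a b c d))))
      ≈⟨ ∑-cong n (λ c → ∑-swap n n _) ⟩
    ∑ n (λ c → ∑ n (λ d → ∑ n (λ a → ∑ n (λ b → f a b c d)))) ∎

  ∑-head : ∀ n (f : ℕ → Carrier) → ∑ (suc n) f ≈ f 0 + ∑ n (f ∘ suc)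
  ∑-head zero    f = +-comm 0# (f 0)
  ∑-head (suc n) f = trans (+-congʳ (∑-head n f)) (+-assoc _ _ _)

  ∏-head : ∀ n (f : ℕ → Carrier) → ∏ (suc n) f ≈ f 0 * ∏ n (f ∘ suc)
  ∏-head zero    f = *-comm 1# (f 0)
  ∏-head (suc n) f = trans (*-congʳ (∏-head n f)) (*-assoc _ _ _)

  -- Substitutes n = k + 1 + d. The square on the right exceeds the triangle only by terms with
  -- `N ≤ n`, which vanish by hypothesis.
  ∑-triangle : ∀ N (f : ℕ → ℕ → Carrier) → (∀ n k → N ≤ n → f n k ≈ 0#) →
    ∑ N (λ n → ∑ n (f n)) ≈ ∑ N (λ k → ∑ N (λ d → f (suc (k ℕ.+ d)) k))
  ∑-triangle zero    f f≈0 = refl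
  ∑-triangle (suc N) f f≈0 = begin
    ∑ (suc N) (λ n → ∑ n (f n))
      ≈⟨ ∑-head N _ ⟩
    0# + ∑ N (λ n → ∑ (suc n) (f (suc n)))
      ≈⟨ +-identityˡ _ ⟩
    ∑ N (λ n → ∑ (suc n) (f (suc n)))
      ≈⟨ ∑-cong N (λ n → ∑-head n (f (suc n))) ⟩
    ∑ N (λ n → f (suc n) 0 + ∑ n (f (suc n) ∘ suc))
      ≈⟨ ∑-+ N _ _ ⟩
    ∑ N (λ n → f (suc n) 0) + ∑ N (λ n → ∑ n (f (suc n) ∘ suc))
      ≈⟨ +-cong (extend (λ d → f (suc d) 0) (f≈0 (suc N) 0 ℕ.≤-refl))
                (∑-triangle N (λ n k → f (suc n) (suc k)) (λ n k N≤n → f≈0 (suc n) (suc k) (s≤s N≤n))) ⟩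
    ∑ (suc N) (λ d → f (suc d) 0) + ∑ N (λ k → ∑ N (λ d → f (suc (suc (k ℕ.+ d))) (suc k)))
      ≈⟨ +-congˡ (∑-cong N (λ k → extend (λ d → f (suc (suc (k ℕ.+ d))) (suc k))
           (f≈0 _ _ (s≤s (ℕ.≤-trans (ℕ.m≤n+m N k) (ℕ.n≤1+n _)))))) ⟩
    ∑ (suc N) (λ d → f (suc d) 0) + ∑ N (λ k → ∑ (suc N) (λ d → f (suc (suc (k ℕ.+ d))) (suc k)))
      ≈⟨ ∑-head N _ ⟨
    ∑ (suc N) (λ k → ∑ (suc N) (λ d → f (suc (k ℕ.+ d)) k)) ∎
    where
    extend : (g : ℕ → Carrier) → g N ≈ 0# → ∑ N g ≈ ∑ (suc N) g
    extend g gN≈0 = sym (trans (+-congˡ gN≈0) (+-identityʳ _))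

  ∑-even-odd : ∀ n (f : ℕ → Carrier) →
    ∑ (2 ℕ.* n) f ≈ ∑ n (λ k → f (2 ℕ.* k)) + ∑ n (λ k → f (suc (2 ℕ.* k)))
  ∑-even-odd zero    f = sym (+-identityˡ 0#)
  ∑-even-odd (suc n) f = begin
    ∑ (2 ℕ.* suc n) f
      ≡⟨ ≡.cong (λ m → ∑ m f) (ℕ.*-suc 2 n) ⟩
    ∑ (2 ℕ.* n) f + f (2 ℕ.* n) + f (suc (2 ℕ.* n))
      ≈⟨ +-congʳ (+-congʳ (∑-even-odd n f)) ⟩
    (∑ n _ + ∑ n _) + f (2 ℕ.* n) + f (suc (2 ℕ.* n))
      ≈⟨ solve 4 (λ a b c d → a :+ b :+ c :+ d := a :+ c :+ (b :+ d)) refl _ _ _ _ ⟩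
    ∑ (suc n) (λ k → f (2 ℕ.* k)) + ∑ (suc n) (λ k → f (suc (2 ℕ.* k))) ∎

-- Truncated inverses in a ring where a power of q vanishes.

VanishingPower : ∀ {c ℓ} (R : CommutativeRing c ℓ) → ℕ → CommutativeRing.Carrier R → Set ℓ
VanishingPower R N q = q ^ N ≈ 0#
  where
  open CommutativeRing R
  open Expressions rawRing

FourVanishes : ∀ {c ℓ} → CommutativeRing c ℓ → Set ℓ
FourVanishes R = (1# + 1#) + (1# + 1#) ≈ 0#
  where open CommutativeRing R

module Nilpotent {c ℓ} (R : CommutativeRing c ℓ) (N : ℕ) (q : CommutativeRing.Carrier R)
  (q^N≈0 : VanishingPower R N q) where
  open CommutativeRing R hiding (_-_)
  open FiniteSums R
  open import Relation.Binary.Reasoning.Setoid setoid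
  open SemiringSolver commutativeSemiring using (solve; con; _:+_; _:*_; _:=_)
  open import Algebra.Properties.Ring ring
  open import Algebra.Properties.AbelianGroup +-abelianGroup
  open import Algebra.Properties.CommutativeSemiring.Exp commutativeSemiring
    using (^-congˡ; ^-congʳ; ^-homo-*; ^-assocʳ; ^-distrib-*)
  open import Algebra.Properties.Semiring.Mult semiring using () renaming (_×_ to _·_)

  x-y+y : ∀ x y → (x - y) + y ≈ x
  x-y+y x y = trans (+-assoc x (- y) y) (trans (+-congˡ (-‿inverseˡ y)) (+-identityʳ x))

  sub-intro : ∀ {x y z} → x ≈ z + y → x - y ≈ z
  sub-intro {x} {y} {z} x≈z+y = begin
    x - y        ≈⟨ +-congʳ x≈z+y ⟩
    z + y - y    ≈⟨ +-assoc z y (- y) ⟩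
    z + (y - y)  ≈⟨ +-congˡ (-‿inverseʳ y) ⟩
    z + 0#       ≈⟨ +-identityʳ z ⟩
    z            ∎

  1-[1-x] : ∀ x → 1# - (1# - x) ≈ x
  1-[1-x] x = sub-intro (trans (sym (x-y+y 1# x)) (+-comm _ x))

  -- Plays the part of a zero constant term: the `N`-th power of such an element vanishes, which is
  -- what makes the truncated geometric series an inverse.
  Small : Carrier → Set _
  Small x = ∃ λ w → x ≈ q * w

  small-cong : ∀ {x y} → x ≈ y → Small x → Small y
  small-cong x≈y (w , x≈qw) = w , trans (sym x≈y) x≈qw

  small-*ʳ : ∀ {x} y → Small x → Small (x * y)
  small-*ʳ y (w , x≈qw) = w * y , trans (*-congʳ x≈qw) (*-assoc q w y)

  small-neg : ∀ {x} → Small x → Small (- x)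
  small-neg (w , x≈qw) = - w , trans (-‿cong x≈qw) (-‿distribʳ-* q w)

  small-+ : ∀ {x y} → Small x → Small y → Small (x + y)
  small-+ (w , x≈qw) (v , y≈qv) = w + v , trans (+-cong x≈qw y≈qv) (sym (distribˡ q w v))

  small-q^suc : ∀ n → Small (q ^ suc n)
  small-q^suc n = q ^ n , refl

  small-q : Small q
  small-q = 1# , sym (*-identityʳ q)

  small-nilpotent : ∀ {x} → Small x → x ^ N ≈ 0#
  small-nilpotent {x} (w , x≈qw) = begin
    x ^ N          ≈⟨ ^-congˡ N x≈qw ⟩
    (q * w) ^ N    ≈⟨ ^-distrib-* q w N ⟩
    q ^ N * w ^ N  ≈⟨ *-congʳ q^N≈0 ⟩
    0# * w ^ N     ≈⟨ zeroˡ _ ⟩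
    0#             ∎

  q^≥N≈0 : ∀ {e} → N ≤ e → q ^ e ≈ 0#
  q^≥N≈0 {e} N≤e = begin
    q ^ e                    ≡⟨ ≡.cong (q ^_) (≡.sym (ℕ.m+[n∸m]≡n N≤e)) ⟩
    q ^ (N ℕ.+ (e ℕ.∸ N))    ≈⟨ ^-homo-* q N (e ℕ.∸ N) ⟩
    q ^ N * q ^ (e ℕ.∸ N)    ≈⟨ *-congʳ q^N≈0 ⟩
    0# * q ^ (e ℕ.∸ N)       ≈⟨ zeroˡ _ ⟩
    0#                       ∎

  -- The usual telescoping for `w = 1 - t`, phrased without subtraction so that the semiring solver
  -- applies.
  geometric : ∀ {w t} → w + t ≈ 1# → ∀ n → w * ∑ n (t ^_) + t ^ n ≈ 1#
  geometric {w} {t} w+t≈1 zero    = trans (+-congʳ (zeroʳ w)) (+-identityˡ 1#)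
  geometric {w} {t} w+t≈1 (suc n) = begin
    w * (∑ n (t ^_) + t ^ n) + t * t ^ n
      ≈⟨ solve 4 (λ w t s p → w :* (s :+ p) :+ t :* p := w :* s :+ (w :+ t) :* p) refl w t _ _ ⟩
    w * ∑ n (t ^_) + (w + t) * t ^ n
      ≈⟨ +-congˡ (trans (*-congʳ w+t≈1) (*-identityˡ _)) ⟩
    w * ∑ n (t ^_) + t ^ n
      ≈⟨ geometric w+t≈1 n ⟩
    1# ∎

  Unipotent : Carrier → Set _
  Unipotent x = Small (1# - x)

  inv-inverse : ∀ {x} → Unipotent x → x * inv N x ≈ 1#
  inv-inverse {x} u = begin
    x * inv N x                   ≈⟨ +-identityʳ _ ⟨
    x * inv N x + 0#              ≈⟨ +-congˡ (small-nilpotent u) ⟨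
    x * inv N x + (1# - x) ^ N    ≈⟨ geometric (trans (+-comm x _) (x-y+y 1# x)) N ⟩
    1#                            ∎

  inv-cong : ∀ {x y} → x ≈ y → inv N x ≈ inv N y
  inv-cong x≈y = ∑-cong N (λ i → ^-congˡ i (+-congˡ (-‿cong x≈y)))

  inv-unique : ∀ {x z} → Unipotent x → x * z ≈ 1# → inv N x ≈ z
  inv-unique {x} {z} u xz≈1 = begin
    inv N x              ≈⟨ *-identityʳ _ ⟨
    inv N x * 1#         ≈⟨ *-congˡ xz≈1 ⟨
    inv N x * (x * z)    ≈⟨ solve 3 (λ i x z → i :* (x :* z) := (x :* i) :* z) refl _ x z ⟩
    (x * inv N x) * z    ≈⟨ *-congʳ (inv-inverse u) ⟩
    1# * z               ≈⟨ *-identityˡ z ⟩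
    z                    ∎

  unipotent-1- : ∀ {x} → Small x → Unipotent (1# - x)
  unipotent-1- s = small-cong (sym (1-[1-x] _)) s

  unipotent-1+ : ∀ {x} → Small x → Unipotent (1# + x)
  unipotent-1+ {x} s = small-cong (sym (sub-intro (sym eq))) (small-neg s)
    where
    eq : - x + (1# + x) ≈ 1#
    eq = trans (solve 3 (λ n o x → n :+ (o :+ x) := o :+ (n :+ x)) refl (- x) 1# x)
           (trans (+-congˡ (-‿inverseˡ x)) (+-identityʳ 1#))

  unipotent-1 : Unipotent 1#
  unipotent-1 = 0# , trans (-‿inverseʳ 1#) (sym (zeroʳ q))

  -- Rests on 1 - xy = (1 - x) + x (1 - y).
  unipotent-* : ∀ {x y} → Unipotent x → Unipotent y → Unipotent (x * y)
  unipotent-* {x} {y} u v =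
    small-cong (sym (sub-intro (sym eq))) (small-+ u (small-cong (*-comm _ x) (small-*ʳ x v)))
    where
    eq : (1# - x) + x * (1# - y) + x * y ≈ 1#
    eq = begin
      (1# - x) + x * (1# - y) + x * y
        ≈⟨ solve 4 (λ a x b y → a :+ x :* b :+ x :* y := a :+ x :* (b :+ y)) refl (1# - x) x (1# - y) y ⟩
      (1# - x) + x * ((1# - y) + y)
        ≈⟨ +-congˡ (trans (*-congˡ (x-y+y 1# y)) (*-identityʳ x)) ⟩
      (1# - x) + x
        ≈⟨ x-y+y 1# x ⟩
      1# ∎

  inv-* : ∀ {x y} → Unipotent x → Unipotent y → inv N (x * y) ≈ inv N x * inv N y
  inv-* {x} {y} u v = inv-unique (unipotent-* u v) (begin
    (x * y) * (inv N x * inv N y)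
      ≈⟨ solve 4 (λ x y i j → (x :* y) :* (i :* j) := (x :* i) :* (y :* j)) refl x y _ _ ⟩
    (x * inv N x) * (y * inv N y)  ≈⟨ *-cong (inv-inverse u) (inv-inverse v) ⟩
    1# * 1#                        ≈⟨ *-identityˡ 1# ⟩
    1#                             ∎)

  inv-1 : inv N 1# ≈ 1#
  inv-1 = inv-unique unipotent-1 (*-identityˡ 1#)

  unipotent-qPoch : ∀ {a} b n → Small a → Unipotent (qPoch a b n)
  unipotent-qPoch b zero    s = unipotent-1
  unipotent-qPoch b (suc n) s = unipotent-* (unipotent-qPoch b n s) (unipotent-1- (small-*ʳ (b ^ n) s))

  inv-qPoch-suc : ∀ {a} b n → Small a →
    inv N (qPoch a b (suc n)) ≈ inv N (qPoch a b n) * inv N (1# - a * b ^ n)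
  inv-qPoch-suc b n s = inv-* (unipotent-qPoch b n s) (unipotent-1- (small-*ʳ (b ^ n) s))

  -- The telescoping quotient (q;q²)_n / (-q;q²)_n and the exact splitting of the series.

  q*[q²]^n : ∀ n → q * (q ^ 2) ^ n ≈ q ^ suc (2 ℕ.* n)
  q*[q²]^n n = *-congˡ (^-assocʳ q 2 n)

  1--q*[q²]^n : ∀ n → 1# - (- q) * (q ^ 2) ^ n ≈ 1# + q ^ suc (2 ℕ.* n)
  1--q*[q²]^n n = +-congˡ (begin
    - ((- q) * (q ^ 2) ^ n)    ≈⟨ -‿cong (-‿distribˡ-* q _) ⟨
    - - (q * (q ^ 2) ^ n)      ≈⟨ ⁻¹-involutive _ ⟩
    q * (q ^ 2) ^ n            ≈⟨ q*[q²]^n n ⟩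
    q ^ suc (2 ℕ.* n)          ∎)

  ratio-suc : ∀ n → ratio N q (suc n) ≈
    ratio N q n * ((1# - q ^ suc (2 ℕ.* n)) * inv N (1# + q ^ suc (2 ℕ.* n)))
  ratio-suc n = begin
    (qPoch q (q ^ 2) n * (1# - q * (q ^ 2) ^ n)) * inv N (qPoch (- q) (q ^ 2) (suc n))
      ≈⟨ *-cong (*-congˡ (+-congˡ (-‿cong (q*[q²]^n n))))
                (trans (inv-qPoch-suc (q ^ 2) n (small-neg small-q)) (*-congˡ (inv-cong (1--q*[q²]^n n)))) ⟩
    (qPoch q (q ^ 2) n * (1# - q ^ suc (2 ℕ.* n)))
      * (inv N (qPoch (- q) (q ^ 2) n) * inv N (1# + q ^ suc (2 ℕ.* n)))
      ≈⟨ solve 4 (λ a b c d → (a :* b) :* (c :* d) := (a :* c) :* (b :* d)) refl _ _ _ _ ⟩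
    ratio N q n * ((1# - q ^ suc (2 ℕ.* n)) * inv N (1# + q ^ suc (2 ℕ.* n))) ∎

  ratio-0 : ratio N q 0 ≈ 1#
  ratio-0 = trans (*-identityˡ _) inv-1

  -- With x = q^(2n+1) one has (1 - x)/(1 + x) + 2x/(1 + x) = 1, so passing from n to n + 1 leaves
  -- the total at its initial value `ratio N q 0`.
  ratio-telescopes : ∀ n → ratio N q n + (∑ n (telescoping N q) + ∑ n (telescoping N q)) ≈ 1#
  ratio-telescopes zero    = trans (+-cong ratio-0 (+-identityˡ 0#)) (+-identityʳ 1#)
  ratio-telescopes (suc n) = begin
    ratio N q (suc n) + ((T + r * (x * i)) + (T + r * (x * i)))
      ≈⟨ +-congʳ (ratio-suc n) ⟩
    r * (w * i) + ((T + r * (x * i)) + (T + r * (x * i)))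
      ≈⟨ solve 5 (λ r w i x t → r :* (w :* i) :+ ((t :+ r :* (x :* i)) :+ (t :+ r :* (x :* i)))
           := r :* (((w :+ x) :+ x) :* i) :+ (t :+ t)) refl r w i x T ⟩
    r * (((w + x) + x) * i) + (T + T)
      ≈⟨ +-congʳ (*-congˡ (*-congʳ (+-congʳ (x-y+y 1# x)))) ⟩
    r * ((1# + x) * i) + (T + T)
      ≈⟨ +-congʳ (*-congˡ (inv-inverse (unipotent-1+ (small-q^suc (2 ℕ.* n))))) ⟩
    r * 1# + (T + T)
      ≈⟨ +-congʳ (*-identityʳ r) ⟩
    r + (T + T)
      ≈⟨ ratio-telescopes n ⟩
    1# ∎
    where
    r = ratio N q n
    x = q ^ suc (2 ℕ.* n)
    w = 1# - x
    i = inv N (1# + x)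
    T = ∑ n (telescoping N q)

  qPoch-head : ∀ a b n → qPoch a b (suc n) ≈ (1# - a) * qPoch (a * b) b n
  qPoch-head a b n = trans (∏-head n _)
    (*-cong (+-congˡ (-‿cong (*-identityʳ a)))
            (∏-cong n (λ k → +-congˡ (-‿cong (sym (*-assoc a b (b ^ k)))))))

  -- The factors (-q;q²)_N cancel, and (q;q²)_N is (1 - q) (q³;q²)_N up to a factor that truncation
  -- turns into 1.
  prefactor*ratio : prefactor N q * ratio N q N ≈ 1# - q
  prefactor*ratio = begin
    (p₋ * inv N p₃) * (p₁ * inv N p₋)
      ≈⟨ *-congˡ (*-congʳ p₁≈) ⟩
    (p₋ * inv N p₃) * (((1# - q) * p₃) * inv N p₋)
      ≈⟨ solve 5 (λ a b c d e → (a :* b) :* ((c :* d) :* e) := c :* ((a :* e) :* (d :* b))) refl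
           p₋ (inv N p₃) (1# - q) p₃ (inv N p₋) ⟩
    (1# - q) * ((p₋ * inv N p₋) * (p₃ * inv N p₃))
      ≈⟨ *-congˡ (*-cong (inv-inverse (unipotent-qPoch (q ^ 2) N (small-neg small-q)))
                         (inv-inverse (unipotent-qPoch (q ^ 2) N (small-q^suc 2)))) ⟩
    (1# - q) * (1# * 1#)
      ≈⟨ *-congˡ (*-identityˡ 1#) ⟩
    (1# - q) * 1#
      ≈⟨ *-identityʳ _ ⟩
    1# - q ∎
    where
    p₋ = qPoch (- q) (q ^ 2) N
    p₁ = qPoch q (q ^ 2) N
    p₃ = qPoch (q ^ 3) (q ^ 2) N
    p₁≈ : p₁ ≈ (1# - q) * p₃
    p₁≈ = begin
      p₁
        ≈⟨ *-identityʳ p₁ ⟨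
      p₁ * 1#
        -- The inserted factor is 1 - q^(2N+1), equal to 1 because N ≤ 2N + 1. With it the product
        -- has N + 1 factors, and N are left once the head 1 - q is split off.
        ≈⟨ *-congˡ (sub-intro (trans (sym (+-identityʳ 1#)) (+-congˡ (sym
             (trans (q*[q²]^n N) (q^≥N≈0 (ℕ.≤-trans (ℕ.m≤n*m N 2) (ℕ.n≤1+n _)))))))) ⟨
      p₁ * (1# - q * (q ^ 2) ^ N)
        ≈⟨ qPoch-head q (q ^ 2) N ⟩
      (1# - q) * p₃ ∎

  -- An exact identity, with no reduction modulo 4. The initial term `h` is written as
  -- `h * (r + (U + U))` by `ratio-telescopes`; then `h + h` becomes 1, and `prefactor*ratio` turns
  -- the part with `r` into `h * (1# - q)`, which is q times the right-hand side of the theorem.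
  separate-half : ∀ h → h + h ≈ 1# →
    prefactor N q * (h + ∑ N (term N q ∘ suc)) ≈ prefactor N q * remainder N q + h * (1# - q)
  separate-half h h+h≈1 = begin
    P * (h + S)
      ≈⟨ distribˡ P h S ⟩
    P * h + P * S
      ≈⟨ +-congʳ (*-congˡ (trans (sym (*-identityʳ h)) (*-congˡ (sym (ratio-telescopes N))))) ⟩
    P * (h * (r + (U + U))) + P * S
      ≈⟨ solve 5 (λ P h r U S → P :* (h :* (r :+ (U :+ U))) :+ P :* S
           := P :* (S :+ (h :+ h) :* U) :+ h :* (P :* r)) refl P h r U S ⟩
    P * (S + (h + h) * U) + h * (P * r)
      ≈⟨ +-cong (*-congˡ (+-congˡ (trans (*-congʳ h+h≈1) (*-identityˡ U)))) (*-congˡ prefactor*ratio) ⟩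
    P * (S + U) + h * (1# - q) ∎
    where
    P = prefactor N q
    S = ∑ N (term N q ∘ suc)
    U = ∑ N (telescoping N q)
    r = ratio N q N

  -- From an arbitrary inverse operation to truncated inverses.

  qPoch-cong : ∀ n {a a′ b b′} → a ≈ a′ → b ≈ b′ → qPoch a b n ≈ qPoch a′ b′ n
  qPoch-cong n a≈ b≈ = ∏-cong n (λ k → +-congˡ (-‿cong (*-cong a≈ (^-congˡ k b≈))))

  -- Abstracts the features by which the given series differ from `Expressions`: the inverse `invS`,
  -- and the constants `const (ℚ.- 1ℚ)` and `minusQ`, which agree with ring negations only
  -- coefficientwise.
  module InverseOperation (_⁻¹ : Carrier → Carrier) (⁻¹-inverse : ∀ {x} → Unipotent x → x * x ⁻¹ ≈ 1#)
    (-1′ -q′ : Carrier) (-1′≈-1 : -1′ ≈ - 1#) (-q′≈-q : -q′ ≈ - q) where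

    jacobi′ summand′ : ℕ → Carrier
    jacobi′ m = ∑ (suc m) (λ p → qPoch -1′ q p * -q′ ^ p * (qPoch q q p) ⁻¹)
    summand′ n = qPoch q (q ^ 2) n * -q′ ^ n * (qPoch -q′ (q ^ 2) n) ⁻¹
      * (1# + q ^ (2 ℕ.* n)) ⁻¹ * jacobi′ (2 ℕ.* n)

    -- That `_⁻¹` respects `_≈_` is not assumed; uniqueness of inverses supplies it on unipotent
    -- elements.
    ⁻¹≈inv : ∀ {x y} → Unipotent y → x ≈ y → x ⁻¹ ≈ inv N y
    ⁻¹≈inv u x≈y = sym (trans (inv-cong (sym x≈y))
      (inv-unique (small-cong u≈ u) (⁻¹-inverse (small-cong u≈ u))))
      where u≈ = +-congˡ (-‿cong (sym x≈y))

    jacobi′≈ : ∀ m → jacobi′ m ≈ jacobi N q m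
    jacobi′≈ m = ∑-cong (suc m) (λ p → *-cong
      (*-cong (qPoch-cong p -1′≈-1 refl) (^-congˡ p -q′≈-q))
      (⁻¹≈inv (unipotent-qPoch q p small-q) refl))

    summand′≈term : ∀ n → summand′ (suc n) ≈ term N q (suc n)
    summand′≈term n = *-cong (*-cong (*-cong (*-congˡ (^-congˡ (suc n) -q′≈-q))
      (⁻¹≈inv (unipotent-qPoch (q ^ 2) (suc n) (small-neg small-q)) (qPoch-cong (suc n) -q′≈-q refl)))
      -- The exponent `2 ℕ.* suc n` computes to the successor of `n ℕ.+ suc (n ℕ.+ 0)`.
      (⁻¹≈inv (unipotent-1+ (small-q^suc (n ℕ.+ suc (n ℕ.+ 0)))) refl))
      (jacobi′≈ (2 ℕ.* suc n))

    1⁻¹≈1 : 1# ⁻¹ ≈ 1#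
    1⁻¹≈1 = trans (⁻¹≈inv unipotent-1 refl) inv-1

    -- At index 0 the factor `1# + q ^ 0` is 2 rather than 1 plus a multiple of `q`, so its inverse
    -- enters as a hypothesis.
    summand′-0 : ∀ {h} → (1# + 1#) ⁻¹ ≈ h → summand′ 0 ≈ h
    summand′-0 {h} 2⁻¹≈h = begin
      1# * 1# * 1# ⁻¹ * (1# + 1#) ⁻¹ * (0# + 1# * 1# * 1# ⁻¹)
        ≈⟨ *-cong (*-cong (*-congˡ 1⁻¹≈1) 2⁻¹≈h) (+-congˡ (*-congˡ 1⁻¹≈1)) ⟩
      1# * 1# * 1# * h * (0# + 1# * 1# * 1#)
        ≈⟨ solve 1 (λ h → con 1 :* con 1 :* con 1 :* h :* (con 0 :+ con 1 :* con 1 :* con 1) := h) refl h ⟩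
      h ∎

    evaluate : ∀ {h x y} → h + h ≈ 1# → (1# + 1#) ⁻¹ ≈ h →
      x ≈ qPoch -q′ (q ^ 2) N → y ≈ qPoch (q ^ 3) (q ^ 2) N →
      x * y ⁻¹ * ∑ (suc N) summand′ ≈ prefactor N q * remainder N q + h * (1# - q)
    evaluate {h} h+h≈1 2⁻¹≈h x≈ y≈ = trans
      (*-cong (*-cong (trans x≈ (qPoch-cong N -q′≈-q refl))
                      (⁻¹≈inv (unipotent-qPoch (q ^ 2) N (small-q^suc 2)) y≈))
              -- Starting from `suc N` summands leaves exactly the `N` terms of `remainder` after
              -- the one of index 0 is removed.
              (trans (∑-head N summand′) (+-cong (summand′-0 2⁻¹≈h) (∑-cong N summand′≈term))))
      (separate-half h h+h≈1)

  -- Lambert series and the conjugation of partitions with two part sizes.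

  lambert : ℕ → Carrier
  lambert e = q ^ e * inv N (1# - q ^ e)

  -- Expands to the sum of q^(nm) over odd m: a part `n` taken with odd multiplicity.
  oddLambert : ℕ → Carrier
  oddLambert n = q ^ n * inv N (1# - q ^ (2 ℕ.* n))

  -- The arguments are spelled as `∑-even-odd` produces them from `lambert ∘ suc`.
  ∑lambert-even ∑lambert-odd : ℕ → Carrier
  ∑lambert-even n = ∑ n (λ k → lambert (2 ℕ.+ 2 ℕ.* k))
  ∑lambert-odd  n = ∑ n (λ k → lambert (suc (2 ℕ.* k)))

  inv-1- : ∀ t → inv N (1# - t) ≈ ∑ N (t ^_)
  inv-1- t = ∑-cong N (λ i → ^-congˡ i (1-[1-x] t))

  inv-1+ : ∀ t → inv N (1# + t) ≈ ∑ N ((- t) ^_)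
  inv-1+ t = trans (inv-cong (+-congˡ (sym (⁻¹-involutive t)))) (inv-1- (- t))

  lambert-expand : ∀ e → lambert e ≈ ∑ N (λ i → q ^ (e ℕ.* suc i))
  lambert-expand e = begin
    q ^ e * inv N (1# - q ^ e)          ≈⟨ *-congˡ (inv-1- (q ^ e)) ⟩
    q ^ e * ∑ N ((q ^ e) ^_)            ≈⟨ ∑-*ˡ N (q ^ e) _ ⟩
    ∑ N (λ i → (q ^ e) ^ suc i)         ≈⟨ ∑-cong N (λ i → ^-assocʳ q e (suc i)) ⟩
    ∑ N (λ i → q ^ (e ℕ.* suc i))       ∎

  q^n*[q^2n]^l : ∀ n l → q ^ n * (q ^ (2 ℕ.* n)) ^ l ≈ q ^ (n ℕ.+ 2 ℕ.* n ℕ.* l)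
  q^n*[q^2n]^l n l = trans (*-congˡ (^-assocʳ q (2 ℕ.* n) l)) (sym (^-homo-* q n (2 ℕ.* n ℕ.* l)))

  oddLambert-expand : ∀ n → oddLambert n ≈ ∑ N (λ l → q ^ (n ℕ.+ 2 ℕ.* n ℕ.* l))
  oddLambert-expand n = begin
    q ^ n * inv N (1# - q ^ (2 ℕ.* n))        ≈⟨ *-congˡ (inv-1- _) ⟩
    q ^ n * ∑ N ((q ^ (2 ℕ.* n)) ^_)          ≈⟨ ∑-*ˡ N (q ^ n) _ ⟩
    ∑ N (λ l → q ^ n * (q ^ (2 ℕ.* n)) ^ l)   ≈⟨ ∑-cong N (q^n*[q^2n]^l n) ⟩
    ∑ N (λ l → q ^ (n ℕ.+ 2 ℕ.* n ℕ.* l))     ∎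

  vanish : ∀ {e} x y → N ≤ e → (q ^ e * x) * y ≈ 0#
  vanish x y N≤e = trans (*-congʳ (trans (*-congʳ (q^≥N≈0 N≤e)) (zeroˡ x))) (zeroˡ y)

  -- Both sides count partitions into parts of exactly two sizes: with both sizes odd on the
  -- right, and with the larger size of odd and the smaller of even multiplicity on the left.
  -- Conjugation, here the substitution swapping (k , d) with (j , i), exchanges them.
  conjugation : ∑ N (λ n → oddLambert (suc n) * ∑lambert-even n) ≈
                ∑ N (λ n → lambert (suc (2 ℕ.* n)) * ∑lambert-odd n)
  conjugation = begin
    ∑ N (λ n → oddLambert (suc n) * ∑lambert-even n)
      ≈⟨ ∑-cong N (λ n → ∑-*ˡ n _ _) ⟩
    ∑ N (λ n → ∑ n (λ k → oddLambert (suc n) * lambert (2 ℕ.+ 2 ℕ.* k)))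
      ≈⟨ ∑-triangle N _ (λ n k N≤n → vanish _ _ (ℕ.≤-trans N≤n (ℕ.n≤1+n n))) ⟩
    ∑ N (λ k → ∑ N (λ d → oddLambert (2 ℕ.+ (k ℕ.+ d)) * lambert (2 ℕ.+ 2 ℕ.* k)))
      ≈⟨ ∑-cong N (λ k → ∑-cong N (λ d →
           trans (*-cong (oddLambert-expand (2 ℕ.+ (k ℕ.+ d))) (lambert-expand (2 ℕ.+ 2 ℕ.* k)))
                 (∑-* N N _ _))) ⟩
    ∑ N (λ k → ∑ N (λ d → ∑ N (λ l → ∑ N (λ e →
      q ^ (2 ℕ.+ (k ℕ.+ d) ℕ.+ 2 ℕ.* (2 ℕ.+ (k ℕ.+ d)) ℕ.* l) * q ^ ((2 ℕ.+ 2 ℕ.* k) ℕ.* suc e)))))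
      ≈⟨ ∑-cong N (λ k → ∑-cong N (λ d → ∑-cong N (λ l → ∑-cong N (λ e → exponents k d l e)))) ⟩
    ∑ N (λ j → ∑ N (λ i → ∑ N (λ k → ∑ N (λ d →
      q ^ (suc (2 ℕ.* suc (k ℕ.+ d)) ℕ.* suc j) * q ^ (suc (2 ℕ.* k) ℕ.* suc i)))))
      ≈⟨ ∑-swap₂ N _ ⟩
    ∑ N (λ k → ∑ N (λ d → ∑ N (λ j → ∑ N (λ i →
      q ^ (suc (2 ℕ.* suc (k ℕ.+ d)) ℕ.* suc j) * q ^ (suc (2 ℕ.* k) ℕ.* suc i)))))
      ≈⟨ ∑-cong N (λ k → ∑-cong N (λ d →
           trans (*-cong (lambert-expand (suc (2 ℕ.* suc (k ℕ.+ d)))) (lambert-expand (suc (2 ℕ.* k))))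
                 (∑-* N N _ _))) ⟨
    ∑ N (λ k → ∑ N (λ d → lambert (suc (2 ℕ.* suc (k ℕ.+ d))) * lambert (suc (2 ℕ.* k))))
      ≈⟨ ∑-triangle N _ (λ n k N≤n →
           vanish _ _ (ℕ.≤-trans N≤n (ℕ.≤-trans (ℕ.m≤n*m n 2) (ℕ.n≤1+n _)))) ⟨
    ∑ N (λ n → ∑ n (λ k → lambert (suc (2 ℕ.* n)) * lambert (suc (2 ℕ.* k))))
      ≈⟨ ∑-cong N (λ n → ∑-*ˡ n _ _) ⟨
    ∑ N (λ n → lambert (suc (2 ℕ.* n)) * ∑lambert-odd n) ∎
    where
    exponents-≡ : ∀ j i k d →
      (2 ℕ.+ (j ℕ.+ i) ℕ.+ 2 ℕ.* (2 ℕ.+ (j ℕ.+ i)) ℕ.* k) ℕ.+ (2 ℕ.+ 2 ℕ.* j) ℕ.* suc d ≡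
      suc (2 ℕ.* suc (k ℕ.+ d)) ℕ.* suc j ℕ.+ suc (2 ℕ.* k) ℕ.* suc i
    exponents-≡ = ℕ-Solver.solve-∀
    exponents : ∀ j i k d →
      q ^ (2 ℕ.+ (j ℕ.+ i) ℕ.+ 2 ℕ.* (2 ℕ.+ (j ℕ.+ i)) ℕ.* k) * q ^ ((2 ℕ.+ 2 ℕ.* j) ℕ.* suc d) ≈
      q ^ (suc (2 ℕ.* suc (k ℕ.+ d)) ℕ.* suc j) * q ^ (suc (2 ℕ.* k) ℕ.* suc i)
    exponents j i k d = trans (sym (^-homo-* q (2 ℕ.+ (j ℕ.+ i) ℕ.+ 2 ℕ.* (2 ℕ.+ (j ℕ.+ i)) ℕ.* k) _))
      (trans (^-congʳ q (exponents-≡ j i k d)) (^-homo-* q (suc (2 ℕ.* suc (k ℕ.+ d)) ℕ.* suc j) _))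

  ν : ℕ → Carrier
  ν n = n · 1#

  -- The left side is the sum of j z^j for j up to n. Its nonzero terms are (j + 1) z^(j+1) with j <
  -- n, and these split as on the right.
  weighted-geometric : ∀ z n →
    ∑ n (λ j → ν j * z ^ j) + ν n * z ^ n ≈ z * ∑ n (z ^_) + z * ∑ n (λ j → ν j * z ^ j)
  weighted-geometric z zero    =
    solve 2 (λ o z → con 0 :+ con 0 :* o := z :* con 0 :+ z :* con 0) refl 1# z
  weighted-geometric z (suc n) = begin
    (D + ν n * p) + (1# + ν n) * (z * p)
      ≈⟨ solve 4 (λ D v p z → (D :+ v :* p) :+ (con 1 :+ v) :* (z :* p)
           := (D :+ v :* p) :+ (z :* p :+ z :* (v :* p))) refl D (ν n) p z ⟩
    (D + ν n * p) + (z * p + z * (ν n * p))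
      ≈⟨ +-congʳ (weighted-geometric z n) ⟩
    (z * G + z * D) + (z * p + z * (ν n * p))
      ≈⟨ solve 5 (λ D v p z G → (z :* G :+ z :* D) :+ (z :* p :+ z :* (v :* p))
           := z :* (G :+ p) :+ z :* (D :+ v :* p)) refl D (ν n) p z G ⟩
    z * (G + p) + z * (D + ν n * p) ∎
    where
    D = ∑ n (λ j → ν j * z ^ j)
    G = ∑ n (z ^_)
    p = z ^ n

  z/[1-z]² : ∀ {z} → Small z → (z * inv N (1# - z)) * inv N (1# - z) ≈ ∑ N (λ j → ν j * z ^ j)
  z/[1-z]² {z} s = begin
    (z * i) * i              ≈⟨ *-congʳ (*-congˡ (inv-1- z)) ⟩
    (z * G) * i              ≈⟨ *-congʳ zG≈ ⟩
    ((1# - z) * D) * i       ≈⟨ solve 3 (λ w D i → (w :* D) :* i := D :* (w :* i)) refl (1# - z) D i ⟩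
    D * ((1# - z) * i)       ≈⟨ *-congˡ (inv-inverse (unipotent-1- s)) ⟩
    D * 1#                   ≈⟨ *-identityʳ D ⟩
    D                        ∎
    where
    i = inv N (1# - z)
    G = ∑ N (z ^_)
    D = ∑ N (λ j → ν j * z ^ j)
    D≈ : D ≈ z * G + z * D
    D≈ = trans (trans (sym (+-identityʳ D))
                      (+-congˡ (sym (trans (*-congˡ (small-nilpotent s)) (zeroʳ (ν N))))))
               (weighted-geometric z N)
    zG≈ : z * G ≈ (1# - z) * D
    zG≈ = begin
      z * G                    ≈⟨ sub-intro D≈ ⟨
      D - z * D                ≈⟨ +-cong (*-identityˡ D) (sym (-‿distribˡ-* z D)) ⟨
      1# * D + (- z) * D       ≈⟨ distribʳ D 1# (- z) ⟨
      (1# - z) * D             ∎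

  diagonal : ℕ → Carrier
  diagonal n = ∑ N (λ j → ν j * q ^ (suc n ℕ.+ 2 ℕ.* suc n ℕ.* j))

  -- Both factors have the denominator 1 - z with z = q^(2n+2), so the product is q^(n+1) times z/(1
  -- - z)², the sum of j z^j.
  diagonal-term : ∀ n → oddLambert (suc n) * lambert (2 ℕ.+ 2 ℕ.* n) ≈ diagonal n
  diagonal-term n = begin
    (q ^ suc n * i) * lambert (2 ℕ.+ 2 ℕ.* n)
      ≡⟨ ≡.cong (λ e → (q ^ suc n * i) * lambert e) (≡.sym (ℕ.*-suc 2 n)) ⟩
    (q ^ suc n * i) * (z * i)
      ≈⟨ solve 3 (λ x i z → (x :* i) :* (z :* i) := x :* ((z :* i) :* i)) refl (q ^ suc n) i z ⟩
    q ^ suc n * ((z * i) * i)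
      ≈⟨ *-congˡ (z/[1-z]² (small-q^suc (n ℕ.+ suc (n ℕ.+ 0)))) ⟩
    q ^ suc n * ∑ N (λ j → ν j * z ^ j)
      ≈⟨ ∑-*ˡ N (q ^ suc n) _ ⟩
    ∑ N (λ j → q ^ suc n * (ν j * z ^ j))
      ≈⟨ ∑-cong N (λ j → trans (solve 3 (λ x v y → x :* (v :* y) := v :* (x :* y)) refl (q ^ suc n) (ν j) (z ^ j))
                               (*-congˡ (q^n*[q^2n]^l (suc n) j))) ⟩
    diagonal n ∎
    where
    z = q ^ (2 ℕ.* suc n)
    i = inv N (1# - z)

-- The remainder vanishes in a ring where 4 = 0.

module ModuloFour {c ℓ} (R : CommutativeRing c ℓ) (N : ℕ) (q : CommutativeRing.Carrier R)
  (q^N≈0 : VanishingPower R N q)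
  (4≈0 : FourVanishes R) where
  open CommutativeRing R hiding (_-_)
  open FiniteSums R
  open Nilpotent R N q q^N≈0
  open import Relation.Binary.Reasoning.Setoid setoid
  open SemiringSolver commutativeSemiring using (solve; con; _:+_; _:*_; _:=_)
  open import Algebra.Properties.Ring ring
  open import Algebra.Properties.AbelianGroup +-abelianGroup
  open import Algebra.Properties.CommutativeSemiring.Exp commutativeSemiring
    using (^-congʳ; ^-assocʳ)

  4x≈0 : ∀ x → (x + x) + (x + x) ≈ 0#
  4x≈0 x = begin
    (x + x) + (x + x)               ≈⟨ solve 1 (λ x → (x :+ x) :+ (x :+ x) := (con 2 :+ con 2) :* x) refl x ⟩
    ((1# + 1#) + (1# + 1#)) * x     ≈⟨ *-congʳ 4≈0 ⟩
    0# * x                          ≈⟨ zeroˡ x ⟩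
    0#                              ∎

  drop-4x : ∀ x y → y + ((x + x) + (x + x)) ≈ y
  drop-4x x y = trans (+-congˡ (4x≈0 x)) (+-identityʳ y)

  -- Removes negation, so that identities modulo 4 come within reach of the semiring solver, with an
  -- explicit multiple of 4 to be discarded by `drop-4x`.
  -x≈3x : ∀ x → - x ≈ x + (x + x)
  -x≈3x x = sym (inverseˡ-unique (x + (x + x)) x
    (trans (solve 1 (λ x → (x :+ (x :+ x)) :+ x := (x :+ x) :+ (x :+ x)) refl x) (4x≈0 x)))

  -- The sign (-1)^n is 1 + 2n modulo 4, since 3 (1 + 2n) = 1 + 2 (n + 1) + 4n.
  [-x]^n : ∀ x n → (- x) ^ n ≈ (1# + (ν n + ν n)) * x ^ n
  [-x]^n x zero    = solve 0 (con 1 := (con 1 :+ (con 0 :+ con 0)) :* con 1) refl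
  [-x]^n x (suc n) = begin
    (- x) * (- x) ^ n
      ≈⟨ *-cong (-x≈3x x) ([-x]^n x n) ⟩
    (x + (x + x)) * ((1# + (v + v)) * p)
      ≈⟨ solve 3 (λ x v p → (x :+ (x :+ x)) :* ((con 1 :+ (v :+ v)) :* p)
           := (con 1 :+ ((con 1 :+ v) :+ (con 1 :+ v))) :* (x :* p)
              :+ ((v :* (x :* p) :+ v :* (x :* p)) :+ (v :* (x :* p) :+ v :* (x :* p)))) refl x v p ⟩
    (1# + ((1# + v) + (1# + v))) * (x * p) + ((v * (x * p) + v * (x * p)) + (v * (x * p) + v * (x * p)))
      ≈⟨ drop-4x _ _ ⟩
    (1# + ((1# + v) + (1# + v))) * (x * p) ∎
    where
    v = ν n
    p = x ^ n

  2[1+x]≈2[1-x] : ∀ x → (1# + x) + (1# + x) ≈ (1# - x) + (1# - x)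
  2[1+x]≈2[1-x] x = begin
    (1# + x) + (1# + x)
      ≈⟨ drop-4x x _ ⟨
    ((1# + x) + (1# + x)) + ((x + x) + (x + x))
      ≈⟨ solve 1 (λ x → ((con 1 :+ x) :+ (con 1 :+ x)) :+ ((x :+ x) :+ (x :+ x))
           := (con 1 :+ (x :+ (x :+ x))) :+ (con 1 :+ (x :+ (x :+ x)))) refl x ⟩
    (1# + (x + (x + x))) + (1# + (x + (x + x)))
      ≈⟨ +-cong (+-congˡ (-x≈3x x)) (+-congˡ (-x≈3x x)) ⟨
    (1# - x) + (1# - x) ∎

  -- Under a factor 2 the sign of x is invisible modulo 4; expanding by `1# - x` and flipping its
  -- sign cancels `1# + x`.
  2inv[1+x]≈2inv[1-x] : ∀ {x} → Small x →
    inv N (1# + x) + inv N (1# + x) ≈ inv N (1# - x) + inv N (1# - x)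
  2inv[1+x]≈2inv[1-x] {x} s = begin
    i + i
      ≈⟨ *-identityʳ _ ⟨
    (i + i) * 1#
      ≈⟨ *-congˡ (inv-inverse (unipotent-1- s)) ⟨
    (i + i) * ((1# - x) * j)
      ≈⟨ solve 3 (λ i w j → (i :+ i) :* (w :* j) := ((w :+ w) :* i) :* j) refl i (1# - x) j ⟩
    (((1# - x) + (1# - x)) * i) * j
      ≈⟨ *-congʳ (*-congʳ (2[1+x]≈2[1-x] x)) ⟨
    (((1# + x) + (1# + x)) * i) * j
      ≈⟨ solve 3 (λ w i j → ((w :+ w) :* i) :* j := ((w :* i) :+ (w :* i)) :* j) refl (1# + x) i j ⟩
    (((1# + x) * i) + ((1# + x) * i)) * j
      ≈⟨ *-congʳ (+-cong (inv-inverse (unipotent-1+ s)) (inv-inverse (unipotent-1+ s))) ⟩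
    (1# + 1#) * j
      ≈⟨ solve 1 (λ j → (con 2) :* j := j :+ j) refl j ⟩
    j + j ∎
    where
    i = inv N (1# + x)
    j = inv N (1# - x)

  1--1*x : ∀ x → 1# - (- 1#) * x ≈ 1# + x
  1--1*x x = +-congˡ (trans (-‿cong (-1*x≈-x x)) (⁻¹-involutive x))

  -- The first factor of (-1;q)_(p+1) is 2, and in its presence the remaining factors 1 + q^k may be
  -- replaced by 1 - q^k.
  qPoch[-1] : ∀ p → qPoch (- 1#) q (suc p) ≈ qPoch q q p + qPoch q q p
  qPoch[-1] zero    = trans (*-identityˡ _) (1--1*x 1#)
  qPoch[-1] (suc p) = begin
    qPoch (- 1#) q (suc p) * (1# - (- 1#) * x)
      ≈⟨ *-cong (qPoch[-1] p) (1--1*x x) ⟩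
    (Q + Q) * (1# + x)
      ≈⟨ solve 2 (λ Q w → (Q :+ Q) :* w := Q :* (w :+ w)) refl Q (1# + x) ⟩
    Q * ((1# + x) + (1# + x))
      ≈⟨ *-congˡ (2[1+x]≈2[1-x] x) ⟩
    Q * ((1# - x) + (1# - x))
      ≈⟨ distribˡ Q _ _ ⟩
    Q * (1# - x) + Q * (1# - x) ∎
    where
    x = q ^ suc p
    Q = qPoch q q p

  2[-q]^n : ∀ n → (- q) ^ n + (- q) ^ n ≈ q ^ n + q ^ n
  2[-q]^n n = begin
    (- q) ^ n + (- q) ^ n
      ≈⟨ +-cong ([-x]^n q n) ([-x]^n q n) ⟩
    (1# + (v + v)) * p + (1# + (v + v)) * p
      ≈⟨ solve 2 (λ v p → (con 1 :+ (v :+ v)) :* p :+ (con 1 :+ (v :+ v)) :* p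
           := (p :+ p) :+ ((v :* p :+ v :* p) :+ (v :* p :+ v :* p))) refl v p ⟩
    (p + p) + ((v * p + v * p) + (v * p + v * p))
      ≈⟨ drop-4x _ _ ⟩
    p + p ∎
    where
    v = ν n
    p = q ^ n

  -- By `qPoch[-1]` the term of index p + 1 is 2 (q;q)_p q^(p+1) / (q;q)_(p+1), in which only the
  -- last factor of the denominator survives.
  jacobi-mod4 : ∀ m → jacobi N q m ≈ 1# + (∑ m (lambert ∘ suc) + ∑ m (lambert ∘ suc))
  jacobi-mod4 m = trans (∑-head m _) (+-cong head (trans (∑-cong m tail) (∑-+ m _ _)))
    where
    head : (1# * 1#) * inv N 1# ≈ 1#
    head = trans (*-cong (*-identityˡ 1#) inv-1) (*-identityˡ 1#)
    tail : ∀ p → (qPoch (- 1#) q (suc p) * (- q) ^ suc p) * inv N (qPoch q q (suc p)) ≈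
      lambert (suc p) + lambert (suc p)
    tail p = begin
      (qPoch (- 1#) q (suc p) * (- q) ^ suc p) * inv N (qPoch q q (suc p))
        ≈⟨ *-cong (*-congʳ (qPoch[-1] p)) (inv-qPoch-suc q p small-q) ⟩
      ((Q + Q) * (- q) ^ suc p) * (inv N Q * i)
        ≈⟨ solve 4 (λ Q y j i → ((Q :+ Q) :* y) :* (j :* i) := (Q :* j) :* ((y :+ y) :* i)) refl Q _ (inv N Q) i ⟩
      (Q * inv N Q) * (((- q) ^ suc p + (- q) ^ suc p) * i)
        ≈⟨ *-cong (inv-inverse (unipotent-qPoch q p small-q)) (*-congʳ (2[-q]^n (suc p))) ⟩
      1# * ((q ^ suc p + q ^ suc p) * i)
        ≈⟨ trans (*-identityˡ _) (distribʳ i _ _) ⟩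
      lambert (suc p) + lambert (suc p) ∎
      where
      Q = qPoch q q p
      i = inv N (1# - q ^ suc p)

  -- Each new factor is (1 + 3x)/(1 + x) = 1 + 2x/(1 + x), hence 1 + 2x/(1 - x) modulo 4. In a
  -- product of such factors all cross terms are multiples of 4.
  ratio-mod4 : ∀ n → ratio N q n ≈ 1# + (∑lambert-odd n + ∑lambert-odd n)
  ratio-mod4 zero    = trans ratio-0 (solve 0 (con 1 := con 1 :+ (con 0 :+ con 0)) refl)
  ratio-mod4 (suc n) = begin
    ratio N q (suc n)
      ≈⟨ ratio-suc n ⟩
    ratio N q n * ((1# - x) * i)
      ≈⟨ *-cong (ratio-mod4 n) factor ⟩
    (1# + (O + O)) * (1# + (l + l))
      ≈⟨ solve 2 (λ O l → (con 1 :+ (O :+ O)) :* (con 1 :+ (l :+ l))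
           := (con 1 :+ ((O :+ l) :+ (O :+ l))) :+ ((O :* l :+ O :* l) :+ (O :* l :+ O :* l))) refl O l ⟩
    (1# + ((O + l) + (O + l))) + ((O * l + O * l) + (O * l + O * l))
      ≈⟨ drop-4x _ _ ⟩
    1# + ((O + l) + (O + l)) ∎
    where
    x = q ^ suc (2 ℕ.* n)
    i = inv N (1# + x)
    j = inv N (1# - x)
    l = lambert (suc (2 ℕ.* n))
    O = ∑lambert-odd n
    small-x : Small x
    small-x = small-q^suc (2 ℕ.* n)
    factor : (1# - x) * i ≈ 1# + (l + l)
    factor = begin
      (1# - x) * i
        ≈⟨ *-congʳ (+-congˡ (-x≈3x x)) ⟩
      (1# + (x + (x + x))) * i
        ≈⟨ solve 2 (λ x i → (con 1 :+ (x :+ (x :+ x))) :* i := (con 1 :+ x) :* i :+ x :* (i :+ i)) refl x i ⟩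
      (1# + x) * i + x * (i + i)
        ≈⟨ +-cong (inv-inverse (unipotent-1+ small-x)) (*-congˡ (2inv[1+x]≈2inv[1-x] small-x)) ⟩
      1# + x * (j + j)
        ≈⟨ +-congˡ (distribˡ x j j) ⟩
      1# + (l + l) ∎

  alternating : ℕ → Carrier
  alternating n = (- q) ^ n * inv N (1# + q ^ (2 ℕ.* n))

  2alternating : ∀ n →
    alternating (suc n) + alternating (suc n) ≈ oddLambert (suc n) + oddLambert (suc n)
  2alternating n = begin
    y * i + y * i                     ≈⟨ solve 2 (λ y i → y :* i :+ y :* i := (y :+ y) :* i) refl y i ⟩
    (y + y) * i                       ≈⟨ *-congʳ (2[-q]^n (suc n)) ⟩
    (x + x) * i                       ≈⟨ solve 2 (λ y i → (y :+ y) :* i := y :* (i :+ i)) refl x i ⟩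
    x * (i + i)                       ≈⟨ *-congˡ (2inv[1+x]≈2inv[1-x] (small-q^suc (n ℕ.+ suc (n ℕ.+ 0)))) ⟩
    x * (j + j)                       ≈⟨ distribˡ x j j ⟩
    x * j + x * j                     ∎
    where
    y = (- q) ^ suc n
    x = q ^ suc n
    i = inv N (1# + q ^ (2 ℕ.* suc n))
    j = inv N (1# - q ^ (2 ℕ.* suc n))

  term-mod4 : ∀ n → let cE = oddLambert (suc n) * ∑lambert-even (suc n) in
    term N q (suc n) ≈ alternating (suc n) + (cE + cE)
  term-mod4 n = begin
    (((p₁ * y) * i₋) * i) * jacobi N q (2 ℕ.* suc n)
      ≈⟨ solve 5 (λ a y b i J → (((a :* y) :* b) :* i) :* J := ((a :* b) :* J) :* (y :* i)) refl p₁ y i₋ i _ ⟩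
    (ratio N q (suc n) * jacobi N q (2 ℕ.* suc n)) * b
      ≈⟨ *-congʳ (*-cong (ratio-mod4 (suc n)) (trans (jacobi-mod4 (2 ℕ.* suc n))
           (+-congˡ (+-cong (∑-even-odd (suc n) _) (∑-even-odd (suc n) _))))) ⟩
    ((1# + (O + O)) * (1# + ((O + E) + (O + E)))) * b
      -- The odd Lambert sums come once from `ratio` and once from `jacobi`, each time doubled, so
      -- they drop out and only 1 + 2E remains.
      ≈⟨ solve 3 (λ O E b → ((con 1 :+ (O :+ O)) :* (con 1 :+ ((O :+ E) :+ (O :+ E)))) :* b
           := (b :+ (b :+ b) :* E) :+ (let x = (O :+ O :* (O :+ E)) :* b in (x :+ x) :+ (x :+ x))) refl O E b ⟩
    (b + (b + b) * E) + (((O + O * (O + E)) * b + (O + O * (O + E)) * b)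
      + ((O + O * (O + E)) * b + (O + O * (O + E)) * b))
      ≈⟨ drop-4x _ _ ⟩
    b + (b + b) * E
      ≈⟨ +-congˡ (*-congʳ (2alternating n)) ⟩
    b + (oddLambert (suc n) + oddLambert (suc n)) * E
      ≈⟨ +-congˡ (distribʳ E _ _) ⟩
    b + (oddLambert (suc n) * E + oddLambert (suc n) * E) ∎
    where
    p₁ = qPoch q (q ^ 2) (suc n)
    i₋ = inv N (qPoch (- q) (q ^ 2) (suc n))
    y = (- q) ^ suc n
    i = inv N (1# + q ^ (2 ℕ.* suc n))
    b = alternating (suc n)
    O = ∑lambert-odd (suc n)
    E = ∑lambert-even (suc n)

  oddAlternating : ℕ → Carrier
  oddAlternating n = q ^ suc (2 ℕ.* n) * inv N (1# + q ^ suc (2 ℕ.* n))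

  telescoping-mod4 : ∀ n → let lO = lambert (suc (2 ℕ.* n)) * ∑lambert-odd n in
    telescoping N q n ≈ oddAlternating n + (lO + lO)
  telescoping-mod4 n = begin
    ratio N q n * (x * i)
      ≈⟨ *-congʳ (ratio-mod4 n) ⟩
    (1# + (O + O)) * (x * i)
      ≈⟨ solve 3 (λ O x i → (con 1 :+ (O :+ O)) :* (x :* i) := x :* i :+ (x :* (i :+ i)) :* O) refl O x i ⟩
    x * i + (x * (i + i)) * O
      ≈⟨ +-congˡ (*-congʳ (*-congˡ (2inv[1+x]≈2inv[1-x] (small-q^suc (2 ℕ.* n))))) ⟩
    x * i + (x * (j + j)) * O
      ≈⟨ solve 4 (λ u x j O → u :+ (x :* (j :+ j)) :* O := u :+ ((x :* j) :* O :+ (x :* j) :* O)) refl (x * i) x j O ⟩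
    x * i + ((x * j) * O + (x * j) * O) ∎
    where
    x = q ^ suc (2 ℕ.* n)
    i = inv N (1# + x)
    j = inv N (1# - x)
    O = ∑lambert-odd n

  alternating-expand : ∀ n → alternating (suc n) ≈
    ∑ N (λ j → (1# + ((1# + ν n) + (1# + ν n)) + (ν j + ν j)) * q ^ (suc n ℕ.+ 2 ℕ.* suc n ℕ.* j))
  alternating-expand n = begin
    (- q) ^ suc n * inv N (1# + z)
      ≈⟨ *-congˡ (inv-1+ z) ⟩
    (- q) ^ suc n * ∑ N ((- z) ^_)
      ≈⟨ ∑-*ˡ N _ _ ⟩
    ∑ N (λ j → (- q) ^ suc n * (- z) ^ j)
      ≈⟨ ∑-cong N each ⟩
    ∑ N (λ j → (1# + ((1# + ν n) + (1# + ν n)) + (ν j + ν j)) * q ^ (suc n ℕ.+ 2 ℕ.* suc n ℕ.* j)) ∎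
    where
    z = q ^ (2 ℕ.* suc n)
    each : ∀ j → (- q) ^ suc n * (- z) ^ j ≈
      (1# + ((1# + ν n) + (1# + ν n)) + (ν j + ν j)) * q ^ (suc n ℕ.+ 2 ℕ.* suc n ℕ.* j)
    each j = begin
      (- q) ^ suc n * (- z) ^ j
        ≈⟨ *-cong ([-x]^n q (suc n)) ([-x]^n z j) ⟩
      ((1# + (v + v)) * x) * ((1# + (w + w)) * y)
        ≈⟨ solve 4 (λ v w x y → ((con 1 :+ (v :+ v)) :* x) :* ((con 1 :+ (w :+ w)) :* y)
             := (con 1 :+ (v :+ v) :+ (w :+ w)) :* (x :* y)
                :+ (let t = v :* w :* (x :* y) in (t :+ t) :+ (t :+ t))) refl v w x y ⟩
      (1# + (v + v) + (w + w)) * (x * y)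
        + (((v * w) * (x * y) + (v * w) * (x * y)) + ((v * w) * (x * y) + (v * w) * (x * y)))
        ≈⟨ drop-4x _ _ ⟩
      (1# + (v + v) + (w + w)) * (x * y)
        ≈⟨ *-congˡ (q^n*[q^2n]^l (suc n) j) ⟩
      (1# + (v + v) + (w + w)) * q ^ (suc n ℕ.+ 2 ℕ.* suc n ℕ.* j) ∎
      where
      v = 1# + ν n
      w = ν j
      x = q ^ suc n
      y = z ^ j

  -- The exponent (2j + 1)(n + 1) is written as in `alternating-expand`, so that after exchanging
  -- the sums both expansions can be added term by term.
  oddAlternating-expand : ∀ j → oddAlternating j ≈
    ∑ N (λ n → (1# + (ν n + ν n)) * q ^ (suc n ℕ.+ 2 ℕ.* suc n ℕ.* j))
  oddAlternating-expand j = begin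
    x * inv N (1# + x)
      ≈⟨ *-congˡ (inv-1+ x) ⟩
    x * ∑ N ((- x) ^_)
      ≈⟨ ∑-*ˡ N x _ ⟩
    ∑ N (λ n → x * (- x) ^ n)
      ≈⟨ ∑-cong N (λ n → trans (*-congˡ ([-x]^n x n))
           (trans (solve 3 (λ x a y → x :* (a :* y) := a :* (x :* y)) refl x _ (x ^ n))
             (*-congˡ (trans (^-assocʳ q (suc (2 ℕ.* j)) (suc n)) (^-congʳ q (exponent j n)))))) ⟩
    ∑ N (λ n → (1# + (ν n + ν n)) * q ^ (suc n ℕ.+ 2 ℕ.* suc n ℕ.* j)) ∎
    where
    x = q ^ suc (2 ℕ.* j)
    exponent : ∀ j n → suc (2 ℕ.* j) ℕ.* suc n ≡ suc n ℕ.+ 2 ℕ.* suc n ℕ.* j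
    exponent = ℕ-Solver.solve-∀

  -- The two coefficients of q^((n+1)(2j+1)) add up to (1 + 2(n + 1) + 2j) + (1 + 2n) = 2j + 4(n +
  -- 1).
  alternating-sums : ∑ N (alternating ∘ suc) + ∑ N oddAlternating ≈ ∑ N diagonal + ∑ N diagonal
  alternating-sums = begin
    ∑ N (alternating ∘ suc) + ∑ N oddAlternating
      ≈⟨ +-cong (∑-cong N alternating-expand) (trans (∑-cong N oddAlternating-expand) (∑-swap N N _)) ⟩
    ∑ N (λ n → ∑ N (λ j → A n j * Q n j)) + ∑ N (λ n → ∑ N (λ j → B n * Q n j))
      ≈⟨ trans (sym (∑-+ N _ _)) (∑-cong N (λ n → sym (∑-+ N _ _))) ⟩
    ∑ N (λ n → ∑ N (λ j → A n j * Q n j + B n * Q n j))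
      ≈⟨ ∑-cong N (λ n → ∑-cong N (each n)) ⟩
    ∑ N (λ n → ∑ N (λ j → ν j * Q n j + ν j * Q n j))
      ≈⟨ trans (∑-cong N (λ n → ∑-+ N _ _)) (∑-+ N _ _) ⟩
    ∑ N diagonal + ∑ N diagonal ∎
    where
    A Q : ℕ → ℕ → Carrier
    A n j = 1# + ((1# + ν n) + (1# + ν n)) + (ν j + ν j)
    Q n j = q ^ (suc n ℕ.+ 2 ℕ.* suc n ℕ.* j)
    B : ℕ → Carrier
    B n = 1# + (ν n + ν n)
    each : ∀ n j → A n j * Q n j + B n * Q n j ≈ ν j * Q n j + ν j * Q n j
    each n j = trans
      (solve 3 (λ v w Q →
          (con 1 :+ ((con 1 :+ v) :+ (con 1 :+ v)) :+ (w :+ w)) :* Q :+ (con 1 :+ (v :+ v)) :* Q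
        := (w :* Q :+ w :* Q) :+ (let t = (con 1 :+ v) :* Q in (t :+ t) :+ (t :+ t))) refl (ν n) (ν j) (Q n j))
      (drop-4x _ _)

  remainder≈0 : remainder N q ≈ 0#
  remainder≈0 = begin
    ∑ N (term N q ∘ suc) + ∑ N (telescoping N q)
      ≈⟨ +-cong (trans (∑-cong N term-mod4) (trans (∑-+ N _ _) (+-congˡ (∑-+ N _ _))))
                (trans (∑-cong N telescoping-mod4) (trans (∑-+ N _ _) (+-congˡ (∑-+ N _ _)))) ⟩
    (∑ N (alternating ∘ suc) + (C + C)) + (∑ N oddAlternating + (L + L))
      ≈⟨ solve 4 (λ a c b l → (a :+ (c :+ c)) :+ (b :+ (l :+ l)) := (a :+ b) :+ ((c :+ c) :+ (l :+ l))) refl _ C _ L ⟩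
    (∑ N (alternating ∘ suc) + ∑ N oddAlternating) + ((C + C) + (L + L))
      ≈⟨ +-cong alternating-sums (+-congʳ (+-cong C≈ C≈)) ⟩
    (D + D) + (((L + D) + (L + D)) + (L + L))
      ≈⟨ solve 2 (λ D L → (D :+ D) :+ (((L :+ D) :+ (L :+ D)) :+ (L :+ L))
           := ((D :+ L) :+ (D :+ L)) :+ ((D :+ L) :+ (D :+ L))) refl D L ⟩
    ((D + L) + (D + L)) + ((D + L) + (D + L))
      ≈⟨ 4x≈0 (D + L) ⟩
    0# ∎
    where
    C = ∑ N (λ n → oddLambert (suc n) * ∑lambert-even (suc n))
    L = ∑ N (λ n → lambert (suc (2 ℕ.* n)) * ∑lambert-odd n)
    D = ∑ N diagonal
    -- `D` is split off as the last term, k = n, of `∑lambert-even (suc n)`; the shorter sums are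
    -- those of `conjugation`.
    C≈ : C ≈ L + D
    C≈ = begin
      ∑ N (λ n → oddLambert (suc n) * (∑lambert-even n + lambert (2 ℕ.+ 2 ℕ.* n)))
        ≈⟨ trans (∑-cong N (λ n → distribˡ _ _ _)) (∑-+ N _ _) ⟩
      ∑ N (λ n → oddLambert (suc n) * ∑lambert-even n)
        + ∑ N (λ n → oddLambert (suc n) * lambert (2 ℕ.+ 2 ℕ.* n))
        ≈⟨ +-cong conjugation (∑-cong N diagonal-term) ⟩
      L + D ∎

-- Reduction of a subring modulo one of its elements.

-- The ring I / dI for a subring I of K and d ∈ I, realised on the elements of I.
module SubringModulo {c ℓ p} (K : CommutativeRing c ℓ) (I : CommutativeRing.Carrier K → Set p)
  (I-0 : I (CommutativeRing.0# K)) (I-1 : I (CommutativeRing.1# K))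
  (I-+ : ∀ {x y} → I x → I y → I (CommutativeRing._+_ K x y))
  (I-* : ∀ {x y} → I x → I y → I (CommutativeRing._*_ K x y))
  (I-neg : ∀ {x} → I x → I (CommutativeRing.-_ K x))
  (d : CommutativeRing.Carrier K) (I-d : I d) where
  open CommutativeRing K
  open import Relation.Binary.Reasoning.Setoid setoid
  open import Algebra.Properties.Ring ring
  open import Algebra.Properties.AbelianGroup +-abelianGroup
  open SemiringSolver commutativeSemiring using (solve; con; _:+_; _:*_; _:=_)

  Elem : Set (c Level.⊔ p)
  Elem = ∃ I

  infix 4 _≋_
  -- The quotient `w` must itself lie in `I`: for rational series 4 is a unit of `K`, and without
  -- this condition all elements would be congruent.
  _≋_ : Elem → Elem → Set (c Level.⊔ ℓ Level.⊔ p)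
  (x , _) ≋ (y , _) = ∃ λ w → I w × x ≈ y + d * w

  ≈⇒≋ : ∀ {x y : Elem} → proj₁ x ≈ proj₁ y → x ≋ y
  ≈⇒≋ {x} {y} x≈y = 0# , I-0 , trans x≈y (sym (trans (+-congˡ (zeroʳ d)) (+-identityʳ (proj₁ y))))

  ≋-sym : ∀ {x y : Elem} → x ≋ y → y ≋ x
  ≋-sym {x , _} {y , _} (w , Iw , x≈y+dw) = - w , I-neg Iw , (begin
    y                        ≈⟨ +-identityʳ y ⟨
    y + 0#                   ≈⟨ +-congˡ (zeroʳ d) ⟨
    y + d * 0#               ≈⟨ +-congˡ (*-congˡ (-‿inverseʳ w)) ⟨
    y + d * (w - w)          ≈⟨ solve 4 (λ y d w v → y :+ d :* (w :+ v) := (y :+ d :* w) :+ d :* v) refl y d w (- w) ⟩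
    (y + d * w) + d * (- w)  ≈⟨ +-congʳ x≈y+dw ⟨
    x + d * (- w)            ∎)

  ≋-trans : ∀ {x y z : Elem} → x ≋ y → y ≋ z → x ≋ z
  ≋-trans {x , _} {y , _} {z , _} (w , Iw , x≈y+dw) (v , Iv , y≈z+dv) = w + v , I-+ Iw Iv , (begin
    x                    ≈⟨ x≈y+dw ⟩
    y + d * w            ≈⟨ +-congʳ y≈z+dv ⟩
    (z + d * v) + d * w  ≈⟨ solve 4 (λ z d w v → (z :+ d :* v) :+ d :* w := z :+ d :* (w :+ v)) refl z d w v ⟩
    z + d * (w + v)      ∎)

  _⊞_ _⊠_ : Elem → Elem → Elem
  (x , Ix) ⊞ (y , Iy) = x + y , I-+ Ix Iy
  (x , Ix) ⊠ (y , Iy) = x * y , I-* Ix Iy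

  ⊟_ : Elem → Elem
  ⊟ (x , Ix) = - x , I-neg Ix

  ⊞-cong : ∀ {x x′ y y′ : Elem} → x ≋ x′ → y ≋ y′ → (x ⊞ y) ≋ (x′ ⊞ y′)
  ⊞-cong {x , _} {x′ , _} {y , _} {y′ , _} (w , Iw , x≈) (v , Iv , y≈) = w + v , I-+ Iw Iv , (begin
    x + y                          ≈⟨ +-cong x≈ y≈ ⟩
    (x′ + d * w) + (y′ + d * v)    ≈⟨ solve 5 (λ x y d w v →
      (x :+ d :* w) :+ (y :+ d :* v) := (x :+ y) :+ d :* (w :+ v)) refl x′ y′ d w v ⟩
    (x′ + y′) + d * (w + v)        ∎)

  ⊠-cong : ∀ {x x′ y y′ : Elem} → x ≋ x′ → y ≋ y′ → (x ⊠ y) ≋ (x′ ⊠ y′)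
  ⊠-cong {x , _} {x′ , Ix′} {y , Iy} {y′ , _} (w , Iw , x≈) (v , Iv , y≈) =
    w * y + x′ * v , I-+ (I-* Iw Iy) (I-* Ix′ Iv) , (begin
    x * y                             ≈⟨ *-congʳ x≈ ⟩
    (x′ + d * w) * y                  ≈⟨ distribʳ y x′ (d * w) ⟩
    x′ * y + (d * w) * y              ≈⟨ +-congʳ (*-congˡ y≈) ⟩
    x′ * (y′ + d * v) + (d * w) * y   ≈⟨ solve 6 (λ x y d w v z →
      x :* (y :+ d :* v) :+ (d :* w) :* z := x :* y :+ d :* (w :* z :+ x :* v)) refl x′ y′ d w v y ⟩
    x′ * y′ + d * (w * y + x′ * v)    ∎)

  ⊟-cong : ∀ {x y : Elem} → x ≋ y → (⊟ x) ≋ (⊟ y)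
  ⊟-cong {x , _} {y , _} (w , Iw , x≈) = - w , I-neg Iw , (begin
    - x               ≈⟨ -‿cong x≈ ⟩
    - (y + d * w)     ≈⟨ ⁻¹-∙-comm y (d * w) ⟨
    - y - d * w       ≈⟨ +-congˡ (-‿distribʳ-* d w) ⟩
    - y + d * (- w)   ∎)

  subringModulo : CommutativeRing (c Level.⊔ p) (c Level.⊔ ℓ Level.⊔ p)
  subringModulo = record
    { Carrier = Elem
    ; _≈_ = _≋_
    ; _+_ = _⊞_
    ; _*_ = _⊠_
    ; -_  = ⊟_
    ; 0#  = 0# , I-0
    ; 1#  = 1# , I-1
    ; isCommutativeRing = record
      { isRing = record
        { +-isAbelianGroup = record
          { isGroup = record
            { isMonoid = record
              { isSemigroup = record
                { isMagma = record
                  { isEquivalence = record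
                    -- The relation forgets the membership proofs, so unification cannot recover the
                    -- elements and they are passed explicitly.
                    { refl  = λ {x} → ≈⇒≋ {x} {x} refl
                    ; sym   = λ {x} {y} → ≋-sym {x} {y}
                    ; trans = λ {x} {y} {z} → ≋-trans {x} {y} {z}
                    }
                  ; ∙-cong = λ {x} {x′} {y} {y′} → ⊞-cong {x} {x′} {y} {y′}
                  }
                ; assoc = λ x y z → ≈⇒≋ {(x ⊞ y) ⊞ z} {x ⊞ (y ⊞ z)} (+-assoc _ _ _)
                }
              ; identity = (λ x → ≈⇒≋ {(0# , I-0) ⊞ x} {x} (+-identityˡ _))
                         , (λ x → ≈⇒≋ {x ⊞ (0# , I-0)} {x} (+-identityʳ _))
              }
            ; inverse = (λ x → ≈⇒≋ {(⊟ x) ⊞ x} {0# , I-0} (-‿inverseˡ _))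
                      , (λ x → ≈⇒≋ {x ⊞ (⊟ x)} {0# , I-0} (-‿inverseʳ _))
            ; ⁻¹-cong = λ {x} {y} → ⊟-cong {x} {y}
            }
          ; comm = λ x y → ≈⇒≋ {x ⊞ y} {y ⊞ x} (+-comm _ _)
          }
        ; *-cong = λ {x} {x′} {y} {y′} → ⊠-cong {x} {x′} {y} {y′}
        ; *-assoc = λ x y z → ≈⇒≋ {(x ⊠ y) ⊠ z} {x ⊠ (y ⊠ z)} (*-assoc _ _ _)
        ; *-identity = (λ x → ≈⇒≋ {(1# , I-1) ⊠ x} {x} (*-identityˡ _))
                     , (λ x → ≈⇒≋ {x ⊠ (1# , I-1)} {x} (*-identityʳ _))
        ; distrib = (λ x y z → ≈⇒≋ {x ⊠ (y ⊞ z)} {(x ⊠ y) ⊞ (x ⊠ z)} (distribˡ _ _ _))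
                  , (λ x y z → ≈⇒≋ {(y ⊞ z) ⊠ x} {(y ⊠ x) ⊞ (z ⊠ x)} (distribʳ _ _ _))
        }
      ; *-comm = λ x y → ≈⇒≋ {x ⊠ y} {y ⊠ x} (*-comm _ _)
      }
    }

  d≋0 : (d , I-d) ≋ (0# , I-0)
  d≋0 = 1# , I-1 , trans (sym (*-identityʳ d)) (sym (+-identityˡ (d * 1#)))

  private
    module K = Expressions rawRing
    module A = Expressions (CommutativeRing.rawRing subringModulo)

  -- Operations on `Elem` act on first components as in `K`, so this comparison and the following
  -- ones hold up to `≡` and can be used for transport.
  proj₁-∑ : ∀ n {f : ℕ → Elem} {g : ℕ → Carrier} → (∀ i → proj₁ (f i) ≡ g i) → proj₁ (A.∑ n f) ≡ K.∑ n g
  proj₁-∑ zero    f≡g = ≡.refl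
  proj₁-∑ (suc n) f≡g = ≡.cong₂ _+_ (proj₁-∑ n f≡g) (f≡g n)

  proj₁-^ : ∀ x n → proj₁ (x A.^ n) ≡ proj₁ x K.^ n
  proj₁-^ x zero    = ≡.refl
  proj₁-^ x (suc n) = ≡.cong (proj₁ x *_) (proj₁-^ x n)

  proj₁-qPoch : ∀ a b n → proj₁ (A.qPoch a b n) ≡ K.qPoch (proj₁ a) (proj₁ b) n
  proj₁-qPoch a b zero    = ≡.refl
  proj₁-qPoch a b (suc n) = ≡.cong₂ _*_ (proj₁-qPoch a b n)
    (≡.cong (λ y → 1# + (- (proj₁ a * y))) (proj₁-^ b n))

  proj₁-inv : ∀ N x {y} → proj₁ x ≡ y → proj₁ (A.inv N x) ≡ K.inv N y
  proj₁-inv N x ≡.refl = proj₁-∑ N (λ i → proj₁-^ (A._-_ (1# , I-1) x) i)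

  module _ (N : ℕ) (q : Elem) where

    proj₁-jacobi : ∀ m → proj₁ (A.jacobi N q m) ≡ K.jacobi N (proj₁ q) m
    proj₁-jacobi m = proj₁-∑ (suc m) (λ p → ≡.cong₂ _*_
      (≡.cong₂ _*_ (proj₁-qPoch (⊟ (1# , I-1)) q p) (proj₁-^ (⊟ q) p))
      (proj₁-inv N (A.qPoch q q p) (proj₁-qPoch q q p)))

    proj₁-term : ∀ n → proj₁ (A.term N q n) ≡ K.term N (proj₁ q) n
    proj₁-term n = ≡.cong₂ _*_ (≡.cong₂ _*_ (≡.cong₂ _*_ (≡.cong₂ _*_
      (proj₁-qPoch q (q A.^ 2) n)
      (proj₁-^ (⊟ q) n))
      (proj₁-inv N (A.qPoch (⊟ q) (q A.^ 2) n) (proj₁-qPoch (⊟ q) (q A.^ 2) n)))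
      (proj₁-inv N ((1# , I-1) ⊞ (q A.^ (2 ℕ.* n))) (≡.cong (λ y → 1# + y) (proj₁-^ q (2 ℕ.* n)))))
      (proj₁-jacobi (2 ℕ.* n))

    proj₁-telescoping : ∀ n → proj₁ (A.telescoping N q n) ≡ K.telescoping N (proj₁ q) n
    proj₁-telescoping n = ≡.cong₂ _*_
      (≡.cong₂ _*_ (proj₁-qPoch q (q A.^ 2) n)
        (proj₁-inv N (A.qPoch (⊟ q) (q A.^ 2) n) (proj₁-qPoch (⊟ q) (q A.^ 2) n)))
      (≡.cong₂ _*_ (proj₁-^ q (suc (2 ℕ.* n)))
        (proj₁-inv N ((1# , I-1) ⊞ (q A.^ suc (2 ℕ.* n))) (≡.cong (λ y → 1# + y) (proj₁-^ q (suc (2 ℕ.* n))))))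

    proj₁-remainder : proj₁ (A.remainder N q) ≡ K.remainder N (proj₁ q)
    proj₁-remainder = ≡.cong₂ _+_ (proj₁-∑ N (λ n → proj₁-term (suc n))) (proj₁-∑ N proj₁-telescoping)

    proj₁-prefactor : proj₁ (A.prefactor N q) ≡ K.prefactor N (proj₁ q)
    proj₁-prefactor = ≡.cong₂ _*_ (proj₁-qPoch (⊟ q) (q A.^ 2) N)
      (proj₁-inv N (A.qPoch (q A.^ 3) (q A.^ 2) N) (proj₁-qPoch (q A.^ 3) (q A.^ 2) N))

module _ {c ℓ} (R : CommutativeRing c ℓ) where
  open CommutativeRing R hiding (_-_)
  open SemiringSolver commutativeSemiring using (solve; con; _:+_; _:*_; _:=_)

  -- Unpacks a congruence to zero with d = 4; for series, the product with the constant 4 becomes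
  -- coefficientwise addition.
  0+4x≈x+x+x+x : ∀ x → 0# + ((1# + 1#) + (1# + 1#)) * x ≈ (x + x) + (x + x)
  0+4x≈x+x+x+x = solve 1 (λ x → con 0 :+ ((con 1 :+ con 1) :+ (con 1 :+ con 1)) :* x := (x :+ x) :+ (x :+ x)) refl

open SemiringSolver (CommutativeRing.commutativeSemiring ℚ.+-*-commutativeRing)
  using (solve; con; _:+_; _:*_; _:=_)

-- The commutative ring of rational power series modulo q^N.

shift : FPS → FPS
shift f i = f (suc i)

-- Reflects f = f(0) + q `shift f`. This recursion takes the place of the list definition of the
-- product in the inductions below.
⊛-suc : ∀ f g m → (f ⊛ g) (suc m) ≡ f 0 ℚ.* g (suc m) ℚ.+ (shift f ⊛ g) m
⊛-suc f g m = ≡.cong (λ xs → f 0 ℚ.* g (suc m) ℚ.+ sumℚ xs)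
  (≡.trans (map-applyUpTo suc (λ i → f i ℚ.* g (suc m ℕ.∸ i)) (suc m))
           (≡.sym (map-applyUpTo id (λ i → f (suc i) ℚ.* g (m ℕ.∸ i)) (suc m))))

⊛-cong : ∀ m {f f′ g g′ : FPS} → (∀ i → i ≤ m → f i ≡ f′ i) → (∀ i → i ≤ m → g i ≡ g′ i) →
  (f ⊛ g) m ≡ (f′ ⊛ g′) m
⊛-cong zero    f≡ g≡ = ≡.cong (ℚ._+ 0ℚ) (≡.cong₂ ℚ._*_ (f≡ 0 z≤n) (g≡ 0 z≤n))
⊛-cong (suc m) {f} {f′} {g} {g′} f≡ g≡ = begin
  (f ⊛ g) (suc m)                                    ≡⟨ ⊛-suc f g m ⟩
  f 0 ℚ.* g (suc m) ℚ.+ (shift f ⊛ g) m              ≡⟨ ≡.cong₂ ℚ._+_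
    (≡.cong₂ ℚ._*_ (f≡ 0 z≤n) (g≡ (suc m) ℕ.≤-refl))
    (⊛-cong m (λ i i≤m → f≡ (suc i) (s≤s i≤m)) (λ i i≤m → g≡ i (ℕ.m≤n⇒m≤1+n i≤m))) ⟩
  f′ 0 ℚ.* g′ (suc m) ℚ.+ (shift f′ ⊛ g′) m          ≡⟨ ⊛-suc f′ g′ m ⟨
  (f′ ⊛ g′) (suc m)                                  ∎
  where open ≡.≡-Reasoning

⊛-sucʳ : ∀ f g m → (f ⊛ g) (suc m) ≡ f (suc m) ℚ.* g 0 ℚ.+ (f ⊛ shift g) m
⊛-sucʳ f g zero    = solve 4 (λ a b c d → a :* d :+ (c :* b :+ con 0) := c :* b :+ (a :* d :+ con 0)) ≡.refl
  (f 0) (g 0) (f 1) (g 1)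
⊛-sucʳ f g (suc m) = begin
  (f ⊛ g) (suc (suc m))
    ≡⟨ ⊛-suc f g (suc m) ⟩
  f 0 ℚ.* g (2 ℕ.+ m) ℚ.+ (shift f ⊛ g) (suc m)
    ≡⟨ ≡.cong (f 0 ℚ.* g (2 ℕ.+ m) ℚ.+_) (⊛-sucʳ (shift f) g m) ⟩
  f 0 ℚ.* g (2 ℕ.+ m) ℚ.+ (f (2 ℕ.+ m) ℚ.* g 0 ℚ.+ (shift f ⊛ shift g) m)
    ≡⟨ solve 3 (λ a b c → a :+ (b :+ c) := b :+ (a :+ c)) ≡.refl
         (f 0 ℚ.* g (2 ℕ.+ m)) (f (2 ℕ.+ m) ℚ.* g 0) ((shift f ⊛ shift g) m) ⟩
  f (2 ℕ.+ m) ℚ.* g 0 ℚ.+ (f 0 ℚ.* g (2 ℕ.+ m) ℚ.+ (shift f ⊛ shift g) m)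
    ≡⟨ ≡.cong (f (2 ℕ.+ m) ℚ.* g 0 ℚ.+_) (⊛-suc f (shift g) m) ⟨
  f (2 ℕ.+ m) ℚ.* g 0 ℚ.+ (f ⊛ shift g) (suc m) ∎
  where open ≡.≡-Reasoning

⊛-comm : ∀ f g m → (f ⊛ g) m ≡ (g ⊛ f) m
⊛-comm f g zero    = ≡.cong (ℚ._+ 0ℚ) (ℚ.*-comm (f 0) (g 0))
⊛-comm f g (suc m) = ≡.trans (⊛-suc f g m)
  (≡.trans (≡.cong₂ ℚ._+_ (ℚ.*-comm (f 0) (g (suc m))) (⊛-comm (shift f) g m)) (≡.sym (⊛-sucʳ g f m)))

⊛-distribʳ : ∀ h f g m → ((f ⊕ g) ⊛ h) m ≡ (f ⊛ h) m ℚ.+ (g ⊛ h) m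
⊛-distribʳ h f g zero    = solve 3 (λ f g h → (f :+ g) :* h :+ con 0 := (f :* h :+ con 0) :+ (g :* h :+ con 0))
  ≡.refl (f 0) (g 0) (h 0)
⊛-distribʳ h f g (suc m) = begin
  ((f ⊕ g) ⊛ h) (suc m)
    ≡⟨ ⊛-suc (f ⊕ g) h m ⟩
  (f 0 ℚ.+ g 0) ℚ.* h (suc m) ℚ.+ ((shift f ⊕ shift g) ⊛ h) m
    ≡⟨ ≡.cong ((f 0 ℚ.+ g 0) ℚ.* h (suc m) ℚ.+_) (⊛-distribʳ h (shift f) (shift g) m) ⟩
  (f 0 ℚ.+ g 0) ℚ.* h (suc m) ℚ.+ ((shift f ⊛ h) m ℚ.+ (shift g ⊛ h) m)
    ≡⟨ solve 5 (λ f g h x y → (f :+ g) :* h :+ (x :+ y) := (f :* h :+ x) :+ (g :* h :+ y)) ≡.refl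
         (f 0) (g 0) (h (suc m)) ((shift f ⊛ h) m) ((shift g ⊛ h) m) ⟩
  (f 0 ℚ.* h (suc m) ℚ.+ (shift f ⊛ h) m) ℚ.+ (g 0 ℚ.* h (suc m) ℚ.+ (shift g ⊛ h) m)
    ≡⟨ ≡.cong₂ ℚ._+_ (⊛-suc f h m) (⊛-suc g h m) ⟨
  (f ⊛ h) (suc m) ℚ.+ (g ⊛ h) (suc m) ∎
  where open ≡.≡-Reasoning

⊛-scaleˡ : ∀ c f g m → ((λ i → c ℚ.* f i) ⊛ g) m ≡ c ℚ.* (f ⊛ g) m
⊛-scaleˡ c f g zero    = solve 3 (λ c f g → (c :* f) :* g :+ con 0 := c :* (f :* g :+ con 0)) ≡.refl c (f 0) (g 0)
⊛-scaleˡ c f g (suc m) = begin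
  ((λ i → c ℚ.* f i) ⊛ g) (suc m)
    ≡⟨ ⊛-suc (λ i → c ℚ.* f i) g m ⟩
  (c ℚ.* f 0) ℚ.* g (suc m) ℚ.+ ((λ i → c ℚ.* shift f i) ⊛ g) m
    ≡⟨ ≡.cong₂ ℚ._+_ (ℚ.*-assoc c (f 0) (g (suc m))) (⊛-scaleˡ c (shift f) g m) ⟩
  c ℚ.* (f 0 ℚ.* g (suc m)) ℚ.+ c ℚ.* (shift f ⊛ g) m
    ≡⟨ ℚ.*-distribˡ-+ c (f 0 ℚ.* g (suc m)) ((shift f ⊛ g) m) ⟨
  c ℚ.* (f 0 ℚ.* g (suc m) ℚ.+ (shift f ⊛ g) m)
    ≡⟨ ≡.cong (c ℚ.*_) (⊛-suc f g m) ⟨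
  c ℚ.* (f ⊛ g) (suc m) ∎
  where open ≡.≡-Reasoning

⊛-assoc : ∀ f g h m → ((f ⊛ g) ⊛ h) m ≡ (f ⊛ (g ⊛ h)) m
⊛-assoc f g h zero    = solve 3 (λ f g h → (f :* g :+ con 0) :* h :+ con 0 := f :* (g :* h :+ con 0) :+ con 0) ≡.refl
  (f 0) (g 0) (h 0)
⊛-assoc f g h (suc m) = begin
  ((f ⊛ g) ⊛ h) (suc m)
    ≡⟨ ⊛-suc (f ⊛ g) h m ⟩
  (f ⊛ g) 0 ℚ.* h (suc m) ℚ.+ (shift (f ⊛ g) ⊛ h) m
    ≡⟨ ≡.cong ((f ⊛ g) 0 ℚ.* h (suc m) ℚ.+_) (begin
      (shift (f ⊛ g) ⊛ h) m
        -- The shift of a product is `f 0` times `shift g` plus `shift f ⊛ g`, which leaves a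
        -- product with a smaller index for the induction.
        ≡⟨ ⊛-cong m {g = h} (λ i _ → ⊛-suc f g i) (λ _ _ → ≡.refl) ⟩
      (((λ i → f 0 ℚ.* shift g i) ⊕ (shift f ⊛ g)) ⊛ h) m
        ≡⟨ ⊛-distribʳ h (λ i → f 0 ℚ.* shift g i) (shift f ⊛ g) m ⟩
      ((λ i → f 0 ℚ.* shift g i) ⊛ h) m ℚ.+ ((shift f ⊛ g) ⊛ h) m
        ≡⟨ ≡.cong₂ ℚ._+_ (⊛-scaleˡ (f 0) (shift g) h m) (⊛-assoc (shift f) g h m) ⟩
      f 0 ℚ.* (shift g ⊛ h) m ℚ.+ (shift f ⊛ (g ⊛ h)) m ∎) ⟩
  (f 0 ℚ.* g 0 ℚ.+ 0ℚ) ℚ.* h (suc m) ℚ.+ (f 0 ℚ.* (shift g ⊛ h) m ℚ.+ (shift f ⊛ (g ⊛ h)) m)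
    ≡⟨ solve 5 (λ f g h x y → (f :* g :+ con 0) :* h :+ (f :* x :+ y) := f :* (g :* h :+ x) :+ y) ≡.refl
         (f 0) (g 0) (h (suc m)) ((shift g ⊛ h) m) ((shift f ⊛ (g ⊛ h)) m) ⟩
  f 0 ℚ.* (g 0 ℚ.* h (suc m) ℚ.+ (shift g ⊛ h) m) ℚ.+ (shift f ⊛ (g ⊛ h)) m
    ≡⟨ ≡.cong (λ x → f 0 ℚ.* x ℚ.+ (shift f ⊛ (g ⊛ h)) m) (⊛-suc g h m) ⟨
  f 0 ℚ.* (g ⊛ h) (suc m) ℚ.+ (shift f ⊛ (g ⊛ h)) m
    ≡⟨ ⊛-suc f (g ⊛ h) m ⟨
  (f ⊛ (g ⊛ h)) (suc m) ∎
  where open ≡.≡-Reasoning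

const-⊛ : ∀ c f m → (const c ⊛ f) m ≡ c ℚ.* f m
const-⊛ c f m = ≡.trans (⊛-cong m {g = f} (λ i _ → scaled i) (λ _ _ → ≡.refl))
  (≡.trans (⊛-scaleˡ c one f m) (≡.cong (c ℚ.*_) (one-⊛ f m)))
  where
  scaled : ∀ i → const c i ≡ c ℚ.* one i
  scaled zero    = ≡.sym (ℚ.*-identityʳ c)
  scaled (suc i) = ≡.sym (ℚ.*-zeroʳ c)
  zero-⊛ : ∀ f m → ((λ _ → 0ℚ) ⊛ f) m ≡ 0ℚ
  zero-⊛ f zero    = ≡.trans (ℚ.+-identityʳ _) (ℚ.*-zeroˡ (f 0))
  zero-⊛ f (suc m) = ≡.trans (⊛-suc (λ _ → 0ℚ) f m)
    (≡.trans (≡.cong₂ ℚ._+_ (ℚ.*-zeroˡ (f (suc m))) (zero-⊛ f m)) (ℚ.+-identityˡ 0ℚ))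
  one-⊛ : ∀ f m → (one ⊛ f) m ≡ f m
  one-⊛ f zero    = ≡.trans (ℚ.+-identityʳ _) (ℚ.*-identityˡ (f 0))
  one-⊛ f (suc m) = ≡.trans (⊛-suc one f m)
    (≡.trans (≡.cong₂ ℚ._+_ (ℚ.*-identityˡ (f (suc m))) (zero-⊛ f m)) (ℚ.+-identityʳ _))

one-⊛ : ∀ f m → (one ⊛ f) m ≡ f m
one-⊛ f m = ≡.trans (const-⊛ 1ℚ f m) (ℚ.*-identityˡ (f m))

const-0 : ∀ m → const 0ℚ m ≡ 0ℚ
const-0 zero    = ≡.refl
const-0 (suc m) = ≡.refl

-- Truncation affects only the equality; elements remain whole series, so the given definitions can
-- be used unchanged.
FPS-mod-q^ : ℕ → CommutativeRing 0ℓ 0ℓ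
FPS-mod-q^ N = record
  { Carrier = FPS
  ; _≈_ = λ f g → ∀ m → m < N → f m ≡ g m
  ; _+_ = _⊕_
  ; _*_ = _⊛_
  ; -_  = λ f m → ℚ.- f m
  ; 0#  = const 0ℚ
  ; 1#  = one
  ; isCommutativeRing = record
    { isRing = record
      { +-isAbelianGroup = record
        { isGroup = record
          { isMonoid = record
            { isSemigroup = record
              { isMagma = record
                { isEquivalence = record
                  { refl  = λ _ _ → ≡.refl
                  ; sym   = λ f≈g m m<N → ≡.sym (f≈g m m<N)
                  ; trans = λ f≈g g≈h m m<N → ≡.trans (f≈g m m<N) (g≈h m m<N)
                  }
                ; ∙-cong = λ f≈ g≈ m m<N → ≡.cong₂ ℚ._+_ (f≈ m m<N) (g≈ m m<N)
                }
              ; assoc = λ f g h m _ → ℚ.+-assoc (f m) (g m) (h m)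
              }
            ; identity = (λ f m _ → ≡.trans (≡.cong (ℚ._+ f m) (const-0 m)) (ℚ.+-identityˡ (f m)))
                       , (λ f m _ → ≡.trans (≡.cong (f m ℚ.+_) (const-0 m)) (ℚ.+-identityʳ (f m)))
            }
          ; inverse = (λ f m _ → ≡.trans (ℚ.+-inverseˡ (f m)) (≡.sym (const-0 m)))
                    , (λ f m _ → ≡.trans (ℚ.+-inverseʳ (f m)) (≡.sym (const-0 m)))
          ; ⁻¹-cong = λ f≈ m m<N → ≡.cong ℚ.-_ (f≈ m m<N)
          }
        ; comm = λ f g m _ → ℚ.+-comm (f m) (g m)
        }
      ; *-cong = λ f≈ g≈ m m<N → ⊛-cong m (λ i i≤m → f≈ i (ℕ.≤-<-trans i≤m m<N))
                                          (λ i i≤m → g≈ i (ℕ.≤-<-trans i≤m m<N))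
      ; *-assoc = λ f g h m _ → ⊛-assoc f g h m
      ; *-identity = (λ f m _ → one-⊛ f m) , (λ f m _ → ≡.trans (⊛-comm f one m) (one-⊛ f m))
      ; distrib = (λ f g h m _ → ≡.trans (⊛-comm f (g ⊕ h) m)
                    (≡.trans (⊛-distribʳ f g h m) (≡.cong₂ ℚ._+_ (⊛-comm g f m) (⊛-comm h f m))))
                , (λ h f g m _ → ⊛-distribʳ h f g m)
      }
    ; *-comm = λ f g m _ → ⊛-comm f g m
    }
  }

-- Inverses of power series.

-- The coefficient list from which Defs computes invS is private there.  Abstracting the first
-- list out of the recursion equation lets unification recover its scalar product with any list.
mutual
  dotInvS : FPS → ℕ → List ℚ → ℚ
  dotInvS a m = _

  invS-suc : ∀ a m →
    invS a (suc m) ≡ ℚ.- (invS a 0 ℚ.* dotInvS a m (map (λ j → a (suc j)) (upTo (suc m))))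
  invS-suc a m with map (λ j → a (suc j)) (upTo (suc m))
  ... | xs = ≡.refl

-- The hidden list runs from the coefficient `invS a m` down to `invS a 0`, so pairing it with `w`
-- is a Cauchy product. An arbitrary `w` is needed, since the induction shifts it while `a` stays
-- fixed.
dotInvS-⊛ : ∀ a w m → dotInvS a m (applyUpTo w (suc m)) ≡ (w ⊛ invS a) m
dotInvS-⊛ a w zero    = ≡.refl
dotInvS-⊛ a w (suc m) = ≡.trans (≡.cong (w 0 ℚ.* invS a (suc m) ℚ.+_) (dotInvS-⊛ a (shift w) m))
  (≡.sym (⊛-suc w (invS a) m))

invS-0 : ∀ a → a 0 ≢ 0ℚ → a 0 ℚ.* invS a 0 ≡ 1ℚ
invS-0 a a₀≢0 with a 0 ℚ.≟ 0ℚ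
... | yes a₀≡0 = contradiction a₀≡0 a₀≢0
... | no  a₀≢0 = ℚ.*-inverseʳ (a 0) {{≢-nonZero a₀≢0}}

⊛-invS : ∀ a → a 0 ≢ 0ℚ → ∀ m → (a ⊛ invS a) m ≡ one m
⊛-invS a a₀≢0 zero    = ≡.trans (ℚ.+-identityʳ _) (invS-0 a a₀≢0)
⊛-invS a a₀≢0 (suc m) = begin
  (a ⊛ invS a) (suc m)
    ≡⟨ ⊛-suc a (invS a) m ⟩
  a 0 ℚ.* invS a (suc m) ℚ.+ X
    ≡⟨ ≡.cong (λ y → a 0 ℚ.* y ℚ.+ X) (≡.trans (invS-suc a m) (≡.cong (λ y → ℚ.- (invS a 0 ℚ.* y)) dot≡X)) ⟩
  a 0 ℚ.* ℚ.- (invS a 0 ℚ.* X) ℚ.+ X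
    ≡⟨ ≡.cong (ℚ._+ X) (≡.trans (≡.sym (ℚ.neg-distribʳ-* (a 0) _)) (≡.cong ℚ.-_ (≡.sym (ℚ.*-assoc (a 0) (invS a 0) X)))) ⟩
  ℚ.- (a 0 ℚ.* invS a 0 ℚ.* X) ℚ.+ X
    ≡⟨ ≡.cong (λ y → ℚ.- (y ℚ.* X) ℚ.+ X) (invS-0 a a₀≢0) ⟩
  ℚ.- (1ℚ ℚ.* X) ℚ.+ X
    ≡⟨ ≡.cong (λ y → ℚ.- y ℚ.+ X) (ℚ.*-identityˡ X) ⟩
  ℚ.- X ℚ.+ X
    ≡⟨ ℚ.+-inverseˡ X ⟩
  0ℚ ∎
  where
  open ≡.≡-Reasoning
  X = (shift a ⊛ invS a) m
  dot≡X : dotInvS a m (map (λ j → a (suc j)) (upTo (suc m))) ≡ X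
  dot≡X = ≡.trans (≡.cong (dotInvS a m) (map-applyUpTo id (shift a) (suc m))) (dotInvS-⊛ a (shift a) m)

-- Integers among the rationals and integral series.

IsInteger : ℚ → Set
IsInteger x = ∃ λ (z : ℤ) → x ≡ z ℚ./ 1

-- `z ℚ./ 1` normalises its fraction, so arithmetic is done on unnormalised rationals, whose second
-- field 0 encodes the denominator 1.
toℚᵘ-/1 : ∀ z → ℚ.toℚᵘ (z ℚ./ 1) ℚᵘ.≃ ℚᵘ.mkℚᵘ z 0
toℚᵘ-/1 z = ℚ.toℚᵘ-fromℚᵘ (ℚᵘ.mkℚᵘ z 0)

/1-+ : ∀ z w → z ℚ./ 1 ℚ.+ w ℚ./ 1 ≡ (z ℤ.+ w) ℚ./ 1
/1-+ z w = ℚ.toℚᵘ-injective (ℚᵘ.≃-trans (ℚ.toℚᵘ-homo-+ (z ℚ./ 1) (w ℚ./ 1))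
  (ℚᵘ.≃-trans (ℚᵘ.+-cong (toℚᵘ-/1 z) (toℚᵘ-/1 w))
  (ℚᵘ.≃-trans (ℚᵘ.*≡* (eq z w)) (ℚᵘ.≃-sym (toℚᵘ-/1 (z ℤ.+ w))))))
  where
  eq : ∀ z w → (z ℤ.* (+ 1) ℤ.+ w ℤ.* (+ 1)) ℤ.* (+ 1) ≡ (z ℤ.+ w) ℤ.* (+ 1)
  eq = ℤ-Solver.solve-∀

/1-* : ∀ z w → (z ℚ./ 1) ℚ.* (w ℚ./ 1) ≡ (z ℤ.* w) ℚ./ 1
/1-* z w = ℚ.toℚᵘ-injective (ℚᵘ.≃-trans (ℚ.toℚᵘ-homo-* (z ℚ./ 1) (w ℚ./ 1))
  (ℚᵘ.≃-trans (ℚᵘ.*-cong (toℚᵘ-/1 z) (toℚᵘ-/1 w)) (ℚᵘ.≃-sym (toℚᵘ-/1 (z ℤ.* w)))))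

/1-neg : ∀ z → ℚ.- (z ℚ./ 1) ≡ (ℤ.- z) ℚ./ 1
/1-neg z = ℚ.toℚᵘ-injective (ℚᵘ.≃-trans (ℚ.toℚᵘ-homo‿- (z ℚ./ 1))
  (ℚᵘ.≃-trans (ℚᵘ.-‿cong (toℚᵘ-/1 z)) (ℚᵘ.≃-sym (toℚᵘ-/1 (ℤ.- z)))))

integer-+ : ∀ {x y} → IsInteger x → IsInteger y → IsInteger (x ℚ.+ y)
integer-+ (z , x≡) (w , y≡) = z ℤ.+ w , ≡.trans (≡.cong₂ ℚ._+_ x≡ y≡) (/1-+ z w)

integer-* : ∀ {x y} → IsInteger x → IsInteger y → IsInteger (x ℚ.* y)
integer-* (z , x≡) (w , y≡) = z ℤ.* w , ≡.trans (≡.cong₂ ℚ._*_ x≡ y≡) (/1-* z w)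

integer-neg : ∀ {x} → IsInteger x → IsInteger (ℚ.- x)
integer-neg (z , x≡) = ℤ.- z , ≡.trans (≡.cong ℚ.-_ x≡) (/1-neg z)

integer-0 : IsInteger 0ℚ
integer-0 = + 0 , ≡.refl

Integral : FPS → Set
Integral f = ∀ m → IsInteger (f m)

integral-const : ∀ z → Integral (const (z ℚ./ 1))
integral-const z zero    = z , ≡.refl
integral-const z (suc m) = integer-0

integral-⊛ : ∀ {f g} → Integral f → Integral g → Integral (f ⊛ g)
integral-⊛ {f} {g} F G zero    = integer-+ {f 0 ℚ.* g 0} (integer-* {f 0} (F 0) (G 0)) integer-0
integral-⊛ {f} {g} F G (suc m) = ≡.subst IsInteger (≡.sym (⊛-suc f g m))
  (integer-+ {f 0 ℚ.* g (suc m)} (integer-* {f 0} (F 0) (G (suc m)))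
    (integral-⊛ {shift f} {g} (λ i → F (suc i)) G m))

-- Orders of vanishing and stabilisation of infinite sums and products.

Vanishes : ℕ → FPS → Set
Vanishes n f = ∀ m → m < n → f m ≡ 0ℚ

vanishes-⊛ʳ : ∀ n f g → Vanishes n g → Vanishes n (f ⊛ g)
vanishes-⊛ʳ n f g g≈0 m m<n = begin
  (f ⊛ g) m           ≡⟨ ⊛-comm f g m ⟩
  (g ⊛ f) m           ≡⟨ ⊛-cong m {g = f} (λ i i≤m → ≡.trans (g≈0 i (ℕ.≤-<-trans i≤m m<n)) (≡.sym (const-0 i)))
                                          (λ _ _ → ≡.refl) ⟩
  (const 0ℚ ⊛ f) m    ≡⟨ const-⊛ 0ℚ f m ⟩
  0ℚ ℚ.* f m          ≡⟨ ℚ.*-zeroˡ (f m) ⟩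
  0ℚ                  ∎
  where open ≡.≡-Reasoning

vanishes-⊛ˡ : ∀ n f g → Vanishes n f → Vanishes n (f ⊛ g)
vanishes-⊛ˡ n f g f≈0 m m<n = ≡.trans (⊛-comm f g m) (vanishes-⊛ʳ n g f f≈0 m m<n)

vanishes-⊛-suc : ∀ n f g → f 0 ≡ 0ℚ → Vanishes n g → Vanishes (suc n) (f ⊛ g)
vanishes-⊛-suc n f g f₀≡0 g≈0 zero    _ =
  ≡.trans (ℚ.+-identityʳ (f 0 ℚ.* g 0)) (≡.trans (≡.cong (ℚ._* g 0) f₀≡0) (ℚ.*-zeroˡ (g 0)))
vanishes-⊛-suc n f g f₀≡0 g≈0 (suc m) (s≤s m<n) = ≡.trans (⊛-suc f g m) (≡.trans
  (≡.cong₂ ℚ._+_ (≡.trans (≡.cong (ℚ._* g (suc m)) f₀≡0) (ℚ.*-zeroˡ (g (suc m))))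
                 (vanishes-⊛ʳ n (shift f) g g≈0 m m<n))
  (ℚ.+-identityˡ 0ℚ))

vanishes-powS : ∀ f n → f 0 ≡ 0ℚ → Vanishes n (powS f n)
vanishes-powS f zero    f₀≡0 m ()
vanishes-powS f (suc n) f₀≡0 = vanishes-⊛-suc n f (powS f n) f₀≡0 (vanishes-powS f n f₀≡0)

stable : ∀ (F : ℕ → ℚ) n₀ → (∀ k → n₀ ≤ k → F (suc k) ≡ F k) → ∀ n → n₀ ≤ n → F n₀ ≡ F n
stable F n₀ step n n₀≤n = go (ℕ.≤⇒≤′ n₀≤n)
  where
  go : ∀ {n} → n₀ ℕ.≤′ n → F n₀ ≡ F n
  go (ℕ.≤′-reflexive ≡.refl) = ≡.refl
  go (ℕ.≤′-step {k} n₀≤′k)    = ≡.trans (go n₀≤′k) (≡.sym (step k (ℕ.≤′⇒≤ n₀≤′k)))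

-- The factors of index k > m are 1 up to order q^(k+1), so they leave the coefficient of q^m alone.
pochInf≡poch : ∀ a b → a 0 ≡ 0ℚ → b 0 ≡ 0ℚ → ∀ {m} N → m < N → pochInf a b m ≡ poch a b N m
pochInf≡poch a b a₀≡0 b₀≡0 {m} N m<N = stable (λ n → poch a b n m) (suc m) step N m<N
  where
  step : ∀ k → suc m ≤ k → poch a b (suc k) m ≡ poch a b k m
  step k m<k = begin
    (poch a b k ⊛ (one ⊝ a ⊛ powS b k)) m
      ≡⟨ ⊛-cong m {f = poch a b k} {g = one ⊝ a ⊛ powS b k} {g′ = one} (λ _ _ → ≡.refl) (λ i i≤m → ≡.trans
           (≡.cong (λ y → one i ℚ.- y)
             (vanishes-⊛-suc k a (powS b k) a₀≡0 (vanishes-powS b k b₀≡0) i (s≤s (ℕ.≤-trans i≤m (ℕ.<⇒≤ m<k)))))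
           (ℚ.+-identityʳ (one i))) ⟩
    (poch a b k ⊛ one) m
      ≡⟨ ⊛-comm (poch a b k) one m ⟩
    (one ⊛ poch a b k) m
      ≡⟨ one-⊛ (poch a b k) m ⟩
    poch a b k m ∎
    where open ≡.≡-Reasoning

sumInf≡sumUpTo : ∀ T → (∀ n → Vanishes n (T n)) → ∀ {m} N → m < N → sumInf T m ≡ sumUpTo N T m
sumInf≡sumUpTo T vanishes {m} N m<N = stable (λ n → sumUpTo n T m) (suc m)
  (λ k m<k → ≡.trans (≡.cong (sumUpTo k T m ℚ.+_) (vanishes k m m<k)) (ℚ.+-identityʳ (sumUpTo k T m))) N m<N

-- The factor `powS minusQ n` alone provides the order.
vanishes-summand : ∀ n → Vanishes n (summand n)
vanishes-summand n =
  vanishes-⊛ˡ n (p ⊛ y ⊛ i₁ ⊛ i₂) (pJac (2 ℕ.* n))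
    (vanishes-⊛ˡ n (p ⊛ y ⊛ i₁) i₂
      (vanishes-⊛ˡ n (p ⊛ y) i₁
        (vanishes-⊛ʳ n p y (vanishes-powS minusQ n ≡.refl))))
  where
  p y i₁ i₂ : FPS
  p  = poch qS (powS qS 2) n
  y  = powS minusQ n
  i₁ = invS (poch minusQ (powS qS 2) n)
  i₂ = invS (one ⊕ powS qS (2 ℕ.* n))

integral-q : Integral qS
integral-q zero          = integer-0
integral-q (suc zero)    = + 1 , ≡.refl
integral-q (suc (suc m)) = integer-0

-- The right-hand side of the theorem multiplied by q.
half[1-q] : FPS
half[1-q] m = ½ ℚ.* (one m ℚ.- qS m)

-- The given series modulo q^N, and divisibility by 4.

module Truncated (M : ℕ) where
  -- A successor, so that `_≈_` sees the coefficient of index `M`, and always the constant term, on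
  -- which `invS-inverse` relies.
  N : ℕ
  N = suc M

  K : CommutativeRing 0ℓ 0ℓ
  K = FPS-mod-q^ N

  open CommutativeRing K using (_≈_)
  open Expressions (CommutativeRing.rawRing K) using (_^_; ∑; qPoch; prefactor; remainder)

  -- Both recursions have the same shape, which gives equality of whole series without
  -- extensionality; rewriting below `invS` then needs only `≡.cong`.
  powS≡^ : ∀ f n → powS f n ≡ f ^ n
  powS≡^ f zero    = ≡.refl
  powS≡^ f (suc n) = ≡.cong (f ⊛_) (powS≡^ f n)

  poch≡qPoch : ∀ a b n → poch a b n ≡ qPoch a b n
  poch≡qPoch a b zero    = ≡.refl
  poch≡qPoch a b (suc n) = ≡.cong₂ _⊛_ (poch≡qPoch a b n) (≡.cong (λ f → one ⊝ a ⊛ f) (powS≡^ b n))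

  sumUpTo≡∑ : ∀ n {F G : ℕ → FPS} → (∀ i → F i ≡ G i) → sumUpTo n F ≡ ∑ n G
  sumUpTo≡∑ zero    F≡G = ≡.refl
  sumUpTo≡∑ (suc n) F≡G = ≡.cong₂ _⊕_ (sumUpTo≡∑ n F≡G) (F≡G n)

  q^N≈0 : qS ^ N ≈ const 0ℚ
  q^N≈0 m m<N = ≡.trans (≡.cong (λ f → f m) (≡.sym (powS≡^ qS N)))
    (≡.trans (vanishes-powS qS N ≡.refl m m<N) (≡.sym (const-0 m)))

  open Nilpotent K N qS q^N≈0 using (Unipotent; module InverseOperation)

  invS-inverse : ∀ {x} → Unipotent x → x ⊛ invS x ≈ one
  invS-inverse {x} (w , 1-x≈qw) m _ = ⊛-invS x x₀≢0 m
    where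
    1-x₀≡0 : 1ℚ ℚ.- x 0 ≡ 0ℚ
    1-x₀≡0 = ≡.trans (1-x≈qw 0 (s≤s z≤n)) (≡.trans (ℚ.+-identityʳ (0ℚ ℚ.* w 0)) (ℚ.*-zeroˡ (w 0)))
    x₀≢0 : x 0 ≢ 0ℚ
    x₀≢0 x₀≡0 with ≡.trans (≡.sym (≡.cong (λ y → 1ℚ ℚ.- y) x₀≡0)) 1-x₀≡0
    ... | ()

  const-neg1≈ : const (ℚ.- 1ℚ) ≈ (λ m → ℚ.- one m)
  const-neg1≈ zero    _ = ≡.refl
  const-neg1≈ (suc m) _ = ≡.refl

  minusQ≈ : minusQ ≈ (λ m → ℚ.- qS m)
  minusQ≈ zero          _ = ≡.refl
  minusQ≈ (suc zero)    _ = ≡.refl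
  minusQ≈ (suc (suc m)) _ = ≡.refl

  open InverseOperation invS (λ {x} → invS-inverse {x}) (const (ℚ.- 1ℚ)) minusQ const-neg1≈ minusQ≈

  pJac≡jacobi′ : ∀ m → pJac m ≡ jacobi′ m
  pJac≡jacobi′ m = sumUpTo≡∑ (suc m) (λ p → ≡.cong₂ _⊛_
    (≡.cong₂ _⊛_ (poch≡qPoch (const (ℚ.- 1ℚ)) qS p) (powS≡^ minusQ p))
    (≡.cong invS (poch≡qPoch qS qS p)))

  summand≡summand′ : ∀ n → summand n ≡ summand′ n
  summand≡summand′ n = ≡.cong₂ _⊛_ (≡.cong₂ _⊛_ (≡.cong₂ _⊛_ (≡.cong₂ _⊛_
    (poch≡qPoch qS (powS qS 2) n)
    (powS≡^ minusQ n))
    (≡.cong invS (poch≡qPoch minusQ (powS qS 2) n)))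
    (≡.cong (λ f → invS (one ⊕ f)) (powS≡^ qS (2 ℕ.* n))))
    (pJac≡jacobi′ (2 ℕ.* n))

  half+half : const ½ ⊕ const ½ ≈ one
  half+half zero    _ = ≡.refl
  half+half (suc m) _ = ≡.refl

  -- Uniqueness of inverses again, by associativity with `const ½`, for the one denominator that is
  -- not unipotent.
  invS-2 : invS (one ⊕ one) ≈ const ½
  invS-2 m m<N = begin
    invS (one ⊕ one) m
      ≡⟨ one-⊛ (invS (one ⊕ one)) m ⟨
    (one ⊛ invS (one ⊕ one)) m
      ≡⟨ ⊛-cong m {g = invS (one ⊕ one)} (λ i _ → half*2 i) (λ _ _ → ≡.refl) ⟨
    ((const ½ ⊛ (one ⊕ one)) ⊛ invS (one ⊕ one)) m
      ≡⟨ ⊛-assoc (const ½) (one ⊕ one) (invS (one ⊕ one)) m ⟩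
    (const ½ ⊛ ((one ⊕ one) ⊛ invS (one ⊕ one))) m
      ≡⟨ ⊛-cong m {f = const ½} (λ _ _ → ≡.refl) (λ i _ → ⊛-invS (one ⊕ one) (λ ()) i) ⟩
    (const ½ ⊛ one) m
      ≡⟨ ⊛-comm (const ½) one m ⟩
    (one ⊛ const ½) m
      ≡⟨ one-⊛ (const ½) m ⟩
    const ½ m ∎
    where
    open ≡.≡-Reasoning
    half*2 : ∀ i → (const ½ ⊛ (one ⊕ one)) i ≡ one i
    half*2 i = ≡.trans (const-⊛ ½ (one ⊕ one) i) (double i)
      where
      double : ∀ i → ½ ℚ.* (one i ℚ.+ one i) ≡ one i
      double zero    = ≡.refl
      double (suc i) = ≡.refl

  mainSeries≡ : ∀ m → m < N → mainSeries m ≡ (prefactor N qS ⊛ remainder N qS) m ℚ.+ half[1-q] m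
  mainSeries≡ m m<N = begin
    mainSeries m
      -- The sum is cut at `suc N` although `N` would do for these coefficients, to fit `evaluate`.
      ≡⟨ ⊛-cong m {f = P} (λ _ _ → ≡.refl) (λ i i≤m → ≡.trans
           (sumInf≡sumUpTo summand vanishes-summand (suc N) (s≤s (ℕ.≤-trans i≤m (ℕ.<⇒≤ m<N))))
           (≡.cong (λ f → f i) (sumUpTo≡∑ (suc N) summand≡summand′))) ⟩
    (P ⊛ ∑ (suc N) summand′) m
      ≡⟨ evaluate {const ½} {pochInf minusQ (powS qS 2)} {pochInf (powS qS 3) (powS qS 2)} half+half invS-2
           (λ i i<N → ≡.trans (pochInf≡poch minusQ (powS qS 2) ≡.refl ≡.refl N i<N)
                              (≡.cong (λ f → f i) (poch≡qPoch minusQ (powS qS 2) N)))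
           (λ i i<N → ≡.trans (pochInf≡poch (powS qS 3) (powS qS 2) ≡.refl ≡.refl N i<N)
                              (≡.cong (λ f → f i) (poch≡qPoch (powS qS 3) (powS qS 2) N)))
           m m<N ⟩
    (prefactor N qS ⊛ remainder N qS) m ℚ.+ (const ½ ⊛ (one ⊝ qS)) m
      ≡⟨ ≡.cong ((prefactor N qS ⊛ remainder N qS) m ℚ.+_) (const-⊛ ½ (one ⊝ qS) m) ⟩
    (prefactor N qS ⊛ remainder N qS) m ℚ.+ half[1-q] m ∎
    where
    open ≡.≡-Reasoning
    P : FPS
    P = pochInf minusQ (powS qS 2) ⊛ invS (pochInf (powS qS 3) (powS qS 2))

  integral-one : Integral one
  integral-one = integral-const (+ 1)

  integral-⊕ : ∀ {f g} → Integral f → Integral g → Integral (f ⊕ g)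
  integral-⊕ {f} {g} F G m = integer-+ {f m} {g m} (F m) (G m)

  -- The resulting ring is the ring of integral power series modulo q^N and 4.
  open SubringModulo K Integral (integral-const (+ 0)) integral-one
    (λ {f} {g} → integral-⊕ {f} {g}) (λ {f} {g} → integral-⊛ {f} {g})
    (λ {f} F m → integer-neg {f m} (F m))
    ((one ⊕ one) ⊕ (one ⊕ one))
    (integral-⊕ {one ⊕ one} {one ⊕ one} (integral-⊕ {one} {one} integral-one integral-one)
                                        (integral-⊕ {one} {one} integral-one integral-one))

  module A = CommutativeRing subringModulo

  q : A.Carrier
  q = qS , integral-q

  private
    module E = Expressions A.rawRing

  q^N≋0 : (q E.^ N) A.≈ A.0#
  q^N≋0 = ≈⇒≋ {q E.^ N} {A.0#} (≡.subst (_≈ const 0ℚ) (≡.sym (proj₁-^ q N)) q^N≈0)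

  open ModuloFour subringModulo N q q^N≋0 d≋0 using (remainder≈0)

  -- The prefactor, with its truncated geometric inverse, is itself an element of the integral ring,
  -- so `remainder≈0` may be multiplied by it. The congruence to zero is by definition the required
  -- pair, up to transport along `proj₁`.
  prefactor*remainder : ∃ λ w → Integral w ×
    prefactor N qS ⊛ remainder N qS ≈ const 0ℚ ⊕ ((one ⊕ one) ⊕ (one ⊕ one)) ⊛ w
  prefactor*remainder = ≡.subst₂
    (λ x y → ∃ λ w → Integral w × x ⊛ y ≈ const 0ℚ ⊕ ((one ⊕ one) ⊕ (one ⊕ one)) ⊛ w)
    (proj₁-prefactor N q) (proj₁-remainder N q)
    (A.trans {P A.* E.remainder N q} {P A.* A.0#} {A.0#}
      (A.*-congˡ {P} {E.remainder N q} {A.0#} remainder≈0) (A.zeroʳ P))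
    where
    P : A.Carrier
    P = E.prefactor N q

-- Divisibility of the individual coefficients.

divBy4-coefficient : ∀ m → DivBy4 (mainSeries m ℚ.- half[1-q] m)
divBy4-coefficient m = z , (begin
  mainSeries m ℚ.- h
    ≡⟨ ≡.cong (ℚ._- h) (Truncated.mainSeries≡ m m ℕ.≤-refl) ⟩
  (p ℚ.+ h) ℚ.- h
    ≡⟨ ℚ.+-assoc p h (ℚ.- h) ⟩
  p ℚ.+ (h ℚ.- h)
    ≡⟨ ≡.cong (p ℚ.+_) (ℚ.+-inverseʳ h) ⟩
  p ℚ.+ 0ℚ
    ≡⟨ ℚ.+-identityʳ p ⟩
  p
    ≡⟨ pr≈4w m ℕ.≤-refl ⟩
  const 0ℚ m ℚ.+ (((one ⊕ one) ⊕ (one ⊕ one)) ⊛ w) m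
    ≡⟨ 0+4x≈x+x+x+x (FPS-mod-q^ (suc m)) w m ℕ.≤-refl ⟩
  (w m ℚ.+ w m) ℚ.+ (w m ℚ.+ w m)
    ≡⟨ ≡.cong (λ x → (x ℚ.+ x) ℚ.+ (x ℚ.+ x)) w≡z/1 ⟩
  (z ℚ./ 1 ℚ.+ z ℚ./ 1) ℚ.+ (z ℚ./ 1 ℚ.+ z ℚ./ 1)
    ≡⟨ ≡.cong (λ x → x ℚ.+ x) (/1-+ z z) ⟩
  (z ℤ.+ z) ℚ./ 1 ℚ.+ (z ℤ.+ z) ℚ./ 1
    ≡⟨ /1-+ (z ℤ.+ z) (z ℤ.+ z) ⟩
  ((z ℤ.+ z) ℤ.+ (z ℤ.+ z)) ℚ./ 1
    ≡⟨ ≡.cong (ℚ._/ 1) (4z z) ⟩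
  (+ 4 ℤ.* z) ℚ./ 1 ∎)
  where
  open ≡.≡-Reasoning
  w : FPS
  w = proj₁ (Truncated.prefactor*remainder m)
  pr≈4w = proj₂ (proj₂ (Truncated.prefactor*remainder m))
  z : ℤ
  z = proj₁ (proj₁ (proj₂ (Truncated.prefactor*remainder m)) m)
  w≡z/1 = proj₂ (proj₁ (proj₂ (Truncated.prefactor*remainder m)) m)
  h p : ℚ
  h = half[1-q] m
  p = (Expressions.prefactor (CommutativeRing.rawRing (FPS-mod-q^ (suc m))) (suc m) qS
        ⊛ Expressions.remainder (CommutativeRing.rawRing (FPS-mod-q^ (suc m))) (suc m) qS) m
  4z : ∀ z → (z ℤ.+ z) ℤ.+ (z ℤ.+ z) ≡ + 4 ℤ.* z
  4z = ℤ-Solver.solve-∀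

open import Data.Rational using (_-_)

theorem1p3 : (k : ℤ) → DivBy4 (lhs k - rhs k)
-- The factor 1/q moves indices by one, and `half[1-q]` computes to ½ at 0, to -½ at 1 and to 0
-- beyond, which are the values of `rhs`.
theorem1p3 (+ zero)       = divBy4-coefficient 1
theorem1p3 (+ suc k)      = divBy4-coefficient (suc (suc k))
theorem1p3 -[1+ zero ]    = divBy4-coefficient 0
theorem1p3 -[1+ suc _ ]   = + 0 , ≡.refl
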